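{- For every integer $n\ge1$, the lattice $(\mathrm{NCCP}(n;312),\le)$ of $312$-avoiding noncommutative crossing partitions, with the order induced from $(\mathrm{NCCP}(n),\le)$, is isomorphic to the Kreweras lattice $(\mathrm{NCP}(n),\subseteq)$.
   Context: **Noncommutative crossing partitions.** Let $[n]=\{1,\dots,n\}$. A noncommutative crossing partition of $[n]$ is a finite sequence $\pi=(\pi_1,\dots,\pi_l)$, written $\pi_1/\cdots/\pi_l$, of nonempty blocks such that each $p\in[n]$ appears exactly once in $\pi$, each block is written as an increasing sequence, and $\max(\pi_i)>\min(\pi_{i+1})$ for $1\le i\le l-1$. $\mathrm{NCCP}(n)$ is the set of these. Concatenating the blocks gives a permutation of $[n]$ in one-line notation, which determines $\pi$ (slashes sit exactly at the descents); $\pi$ is identified with this permutation. $\mathrm{NCCP}(n;312)$ is the subset of those $\pi$ whose permutation avoids the pattern $312$. **Kreweras lattice.** $\mathrm{NCP}(n)$ is the set of $\pi=(\pi_1,\dots,\pi_l)\in\mathrm{NCCP}(n)$ that are non-crossing (there are no $a<b<c<d$ and $i\ne j$ with $a,c\in\pi_i$, $b,d\in\pi_j$) and canonical ($\min(\pi_l)<\min(\pi_{l-1})<\cdots<\min(\pi_1)$). The order $\subseteq$ is refinement: $\pi\subseteq\pi'$ iff every block of $\pi'$ is a union of blocks of $\pi$. **Labeled binary trees.** A labeled binary tree with $n$ nodes is a rooted tree in which each node has at most one left child and at most one right child, with nodes labeled bijectively by $[n]$ so that labels increase from the root to the leaves. Let $\phi(L)$ be the permutation (element of $\mathrm{NCCP}(n)$)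 obtained by reading the labels of $L$ in in-order (left subtree, root, right subtree). The map $\phi$ is a bijection from labeled binary trees with $n$ nodes to $\mathrm{NCCP}(n)$. **Rotation and cover relation.** Let $L$ be a labeled binary tree and let $\mathfrak n$ be a node that is the left child of its parent $\mathfrak n_0$. For a node $\mathfrak m$ let $p(\mathfrak m)$ be the set of nodes on the path from $\mathfrak m$ to the root, both included. Let $LS(\mathfrak n)$ be the set of nodes $\mathfrak m\in p(\mathfrak n)$, $\mathfrak m\neq\mathfrak n$, such that the child of $\mathfrak m$ lying on $p(\mathfrak n)$ is the left child of $\mathfrak m$. A node $\mathfrak n'$ with label smaller than that of $\mathfrak n$ is "right to" $\mathfrak n$ if there is a node $\mathfrak c$ with $\mathfrak n'$ in the right subtree of $\mathfrak c$ and $\mathfrak n$ in the left subtree of $\mathfrak c$. *Choice of $\mathfrak n_a$.* If no node with label smaller than that of $\mathfrak n$ is right to $\mathfrak n$, $\mathfrak n_a$ is any element of $LS(\mathfrak n)$. Otherwise let $\mathfrak n'_l$ be the left-most (in in-order) of the nodes of smaller label right to $\mathfrak n$, let $\mathfrak n_c$ be the node of maximal label in $p(\mathfrak n)\cap p(\mathfrak n'_l)$, and let $\mathfrak n_a$ be any element of $LS(\mathfrak n)\setminus(p(\mathfrak n_c)\setminus\{\mathfrak n_c\})$. *Choice of $S$.* Let $\mathfrak m_0=\mathfrak n$ and let $\mathfrak m_i$ be the left child of $\mathfrak m_{i-1}$ for $1\le i\le p$, with $p$ maximal. Let $S\subseteq\{1,\dots,p\}$ be any subset and $\mathfrak m(S)=\{\mathfrak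 m_i:i\in S\}$. *Two trees.* $T_1$: link the nodes of $\{\mathfrak n\}\cup\mathfrak m(S)$ by left edges in increasing label order (root $\mathfrak n$), each keeping its right subtree from $L$. $T_2$: link the nodes $\mathfrak n_0$ and $\mathfrak m_i$ ($1\le i\le p$, $i\notin S$) by left edges in increasing label order (root $\mathfrak n_0$), each keeping its right subtree from $L$, and replace in $L$ the subtree rooted at $\mathfrak n_0$ by this tree. *Gluing.* For a node $x$ let $\vec q(x)$ be the maximal chain $x$, right child of $x$, right child of that, etc. Take all nodes of $\vec q(\mathfrak n)$ in $T_1$ and of $\vec q(\mathfrak n_a)$ in $T_2$, sort them by increasing label (so $\mathfrak n_a$ is first), and link them successively by right edges; each of these nodes keeps its left subtree from $T_1$ or $T_2$. Replace the chain $\vec q(\mathfrak n_a)$ in $T_2$ by this chain, leaving the rest of $T_2$ unchanged. The resulting labeled binary tree $L'$ on $[n]$ is the rotation of $L$ with respect to the triplet $(\mathfrak n,\mathfrak n_a,\mathfrak m(S))$. For $\pi,\pi'\in\mathrm{NCCP}(n)$, $\pi\lessdot\pi'$ means that $\phi^{ -1}(\pi')$ is a rotation of $\phi^{ -1}(\pi)$ for some triplet, and $\pi\le\pi'$ means that there is a sequence $\pi=\pi_0\lessdot\pi_1\lessdot\cdots\lessdot\pi_m=\pi'$ with $m\ge0$. -}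

module Defs where

open import Data.Nat using (ℕ; suc; _≤_; _<_; _>_; _≟_; _≤?_)
open import Data.Bool using (true; false)
open import Data.Fin using (Fin)
open import Data.Fin.Subset using (Subset; ∁)
open import Data.List using (List; []; _∷_; _++_; [_]; length; lookup; concatMap; applyUpTo; merge)
open import Data.List.NonEmpty using (List⁺; toList; _∷_)
open import Data.List.Extrema.Nat using (max; min)
open import Data.List.Membership.Propositional using (_∈_)
open import Data.List.Relation.Unary.Linked using (Linked)
open import Data.List.Relation.Unary.All using (All)
open import Data.List.Relation.Binary.Permutation.Propositional using (_↭_)
open import Data.List.Relation.Binary.Sublist.Propositional using (_⊆_)
open import Data.Product using (Σ; ∃; ∃₂; ∃-syntax; _×_; _,_; proj₁; proj₂)
open import Data.Sum using (_⊎_)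
open import Data.Vec using ([]; _∷_)
open import Function using (_on_; _⇔_)
open import Relation.Nullary using (¬_; yes; no)
open import Relation.Binary using (Rel)
open import Relation.Binary.PropositionalEquality using (_≡_; _≢_)
open import Relation.Binary.Construct.Closure.ReflexiveTransitive using (Star)
open import Relation.Binary.Lattice.Structures using (IsLattice)

-- [n] = {1, …, n}
⟦1⋯_⟧ : ℕ → List ℕ
⟦1⋯ n ⟧ = applyUpTo suc n

-- The sublist of entries whose position lies in S.
select : ∀ {A : Set} (xs : List A) → Subset (length xs) → List A
select []       []          = []
select (x ∷ xs) (true  ∷ S) = x ∷ select xs S
select (x ∷ xs) (false ∷ S) = select xs S

------------------------------------------------------------------------
-- Noncommutative crossing partitions

Block : Set
Block = List⁺ ℕ

minᵇ maxᵇ : Block → ℕ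
minᵇ (x ∷ xs) = min x xs
maxᵇ (x ∷ xs) = max x xs

-- π₁/⋯/πₗ
BlockSeq : Set
BlockSeq = List Block

word : BlockSeq → List ℕ
word = concatMap toList

record IsNCCP (n : ℕ) (π : BlockSeq) : Set where
  field
    once       : word π ↭ ⟦1⋯ n ⟧
    increasing : All (λ B → Linked _<_ (toList B)) π
    descents   : Linked (λ B C → maxᵇ B > minᵇ C) π

Avoids312 : List ℕ → Set
Avoids312 w = ∀ {x y z} → (x ∷ y ∷ z ∷ []) ⊆ w → ¬ (y < z × z < x)

NonCrossing : BlockSeq → Set
NonCrossing π =
  ∀ {a b c d} {i j : Fin (length π)} → a < b → b < c → c < d → i ≢ j →
  ¬ (a ∈ toList (lookup π i) × c ∈ toList (lookup π i) ×
     b ∈ toList (lookup π j) × d ∈ toList (lookup π j))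

Canonical : BlockSeq → Set
Canonical = Linked (λ B C → minᵇ C < minᵇ B)

record IsNCP (n : ℕ) (π : BlockSeq) : Set where
  field
    isNCCP      : IsNCCP n π
    nonCrossing : NonCrossing π
    canonical   : Canonical π

-- Every block of π′ is the union of some set U of blocks of π.
Refines : Rel BlockSeq _
Refines π π′ =
  ∀ {B} → B ∈ π′ →
  ∃[ U ] (∀ x → x ∈ toList B ⇔ x ∈ word (select π U))

------------------------------------------------------------------------
-- Labeled binary trees; a node is referred to by its label.

data Tree : Set where
  leaf : Tree
  node : (l : Tree) (x : ℕ) (r : Tree) → Tree

inorder : Tree → List ℕ
inorder leaf         = []
inorder (node l x r) = inorder l ++ [ x ] ++ inorder r

-- s ⊑ t: s is the full subtree of t below some position.
data _⊑_ (s : Tree) : Tree → Set where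
  here  : s ⊑ s
  left  : ∀ {l x r} → s ⊑ l → s ⊑ node l x r
  right : ∀ {l x r} → s ⊑ r → s ⊑ node l x r

LeftChild RightChild Child : Tree → ℕ → ℕ → Set
LeftChild  L y x = ∃[ l ] ∃[ r ] ∃[ r₀ ] node (node l y r) x r₀ ⊑ L
RightChild L y x = ∃[ l₀ ] ∃[ l ] ∃[ r ] node l₀ x (node l y r) ⊑ L
Child L y x = LeftChild L y x ⊎ RightChild L y x

record IsLabeledTree (n : ℕ) (L : Tree) : Set where
  field
    labels     : inorder L ↭ ⟦1⋯ n ⟧
    increasing : ∀ {x y} → Child L y x → x < y

-- a ∈ p(m), for a node m of L
OnPath : Tree → ℕ → ℕ → Set
OnPath L m a = Star (Child L) m a

-- m ∈ LS(n)
LS : Tree → ℕ → ℕ → Set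
LS L n m = OnPath L n m × m ≢ n × ∃[ c ] (OnPath L n c × LeftChild L c m)

-- x has a smaller label than n and is right to n.
SmallerRightTo : Tree → ℕ → ℕ → Set
SmallerRightTo L n x =
  x < n ×
  ∃[ c ] ∃[ l ] ∃[ r ] (node l c r ⊑ L × x ∈ inorder r × n ∈ inorder l)

LeftmostSmallerRightTo : Tree → ℕ → ℕ → Set
LeftmostSmallerRightTo L n x =
  SmallerRightTo L n x ×
  (∀ {y} → SmallerRightTo L n y → y ≡ x ⊎ (x ∷ y ∷ []) ⊆ inorder L)

-- c is the node of maximal label in p(x) ∩ p(y).
MaxCommon : Tree → ℕ → ℕ → ℕ → Set
MaxCommon L x y c =
  (OnPath L x c × OnPath L y c) ×
  (∀ {d} → OnPath L x d → OnPath L y d → d ≤ c)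

-- The admissible choices of 𝔫ₐ for n.
Admissible : Tree → ℕ → ℕ → Set
Admissible L n a =
  ((∀ {x} → ¬ SmallerRightTo L n x) × LS L n a)
  ⊎
  (∃[ x ] ∃[ c ] (LeftmostSmallerRightTo L n x × MaxCommon L n x c ×
                  LS L n a × ¬ (OnPath L c a × a ≢ c)))

-- A node on a left (right) chain together with its right (left) subtree.
HangingNode : Set
HangingNode = ℕ × Tree

leftSpine rightSpine : Tree → List HangingNode
leftSpine leaf          = []
leftSpine (node l x r)  = (x , r) ∷ leftSpine l
rightSpine leaf         = []
rightSpine (node l x r) = (x , l) ∷ rightSpine r

linkLeft linkRight : List HangingNode → Tree
linkLeft []              = leaf
linkLeft ((x , r) ∷ ns)  = node (linkLeft ns) x r
linkRight []             = leaf
linkRight ((x , l) ∷ ns) = node l x (linkRight ns)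

-- Sorts by label when both arguments are sorted, as right spines of
-- increasing trees are.
mergeByLabel : List HangingNode → List HangingNode → List HangingNode
mergeByLabel = merge (λ s t → proj₁ s ≤? proj₁ t)

-- Replace the subtree rooted at x by s.
replaceAt : ℕ → Tree → Tree → Tree
replaceAt x s leaf = leaf
replaceAt x s (node l y r) with x ≟ y
... | yes _ = s
... | no  _ = node (replaceAt x s l) y (replaceAt x s r)

-- The two trees into which L is split, when 𝔫₀ has right subtree r₀ and left
-- child 𝔫, and 𝔫 has left subtree l and right subtree r.  The nodes 𝔪₁, …, 𝔪ₚ
-- form the left spine of l (position i carries 𝔪ᵢ₊₁), which lists them in
-- increasing label order, so a selection in spine order is already sorted.
T₁ : (l : Tree) → Subset (length (leftSpine l)) → (𝔫 : ℕ) (r : Tree) → Tree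
T₁ l S 𝔫 r = linkLeft ((𝔫 , r) ∷ select (leftSpine l) S)

T₂ : (l : Tree) → Subset (length (leftSpine l)) → (𝔫₀ : ℕ) (r₀ : Tree) → Tree → Tree
T₂ l S 𝔫₀ r₀ L =
  replaceAt 𝔫₀ (linkLeft ((𝔫₀ , r₀) ∷ select (leftSpine l) (∁ S))) L

-- t₁ is glued into t₂ along the right chains of the root of t₁ and of the
-- node a of t₂, where s is the subtree of t₂ rooted at a.
glue : Tree → (a : ℕ) (s t₂ : Tree) → Tree
glue t₁ a s t₂ =
  replaceAt a (linkRight (mergeByLabel (rightSpine t₁) (rightSpine s))) t₂

-- L′ is the rotation of L with respect to the triplet (𝔫, 𝔫ₐ, 𝔪(S)).
record IsRotation (L L′ : Tree) : Set where
  field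
    {𝔫 𝔫₀ 𝔫ₐ}       : ℕ
    {l r r₀ lₐ rₐ}  : Tree
    𝔫-left     : node (node l 𝔫 r) 𝔫₀ r₀ ⊑ L
    admissible : Admissible L 𝔫 𝔫ₐ
    S          : Subset (length (leftSpine l))
    at-𝔫ₐ      : node lₐ 𝔫ₐ rₐ ⊑ T₂ l S 𝔫₀ r₀ L
    glued      : L′ ≡ glue (T₁ l S 𝔫 r) 𝔫ₐ (node lₐ 𝔫ₐ rₐ) (T₂ l S 𝔫₀ r₀ L)

------------------------------------------------------------------------
-- The two ordered sets

-- L = φ⁻¹(π), where a partition is identified with its permutation.
IsTreeOf : ℕ → BlockSeq → Tree → Set
IsTreeOf n π L = IsLabeledTree n L × inorder L ≡ word π

Cover : ℕ → Rel BlockSeq _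
Cover n π π′ =
  IsNCCP n π × IsNCCP n π′ ×
  ∃₂ λ L L′ → IsTreeOf n π L × IsTreeOf n π′ L′ × IsRotation L L′

NCCP312 NCP : ℕ → Set
NCCP312 n = Σ BlockSeq λ π → IsNCCP n π × Avoids312 (word π)
NCP     n = Σ BlockSeq (IsNCP n)

-- Elements are compared as sequences of blocks, ignoring the proofs.
NCCP312-≈ NCCP312-≤ : ∀ n → Rel (NCCP312 n) _
NCCP312-≈ n = _≡_ on proj₁
-- Intermediate partitions of a chain range over all of NCCP(n).
NCCP312-≤ n = Star (Cover n) on proj₁

NCP-≈ NCP-⊆ : ∀ n → Rel (NCP n) _
NCP-≈ n = _≡_ on proj₁
NCP-⊆ n = Refines on proj₁

IsLatticeOrder : ∀ {A : Set} → Rel A _ → Rel A _ → Set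
IsLatticeOrder _≈_ _≤′_ = ∃₂ λ _∨_ _∧_ → IsLattice _≈_ _≤′_ _∨_ _∧_

{-# OPTIONS --safe #-}
module Submission where

-- Send a labeled tree to the partition of [n] into its right chains (maximal
-- paths of right edges).  Every rotation merges two right chains and keeps the
-- others, so along covers this partition only gets coarser.  The 312-avoiding
-- permutations are those of the trees labelled in preorder, and on these trees
-- the right chains give a bijection onto the noncrossing partitions.
-- Conversely, if the chains of a preorder tree t refine those of a preorder
-- tree u with the same root k, let m′ be the successor of k in its chain in u.
-- Unless the successor in t is m′ as well, m′ heads a chain of t whose merger
-- with that of k is a rotation and still refines u; then recurse into the
-- left and right subtrees.
-- Meets are intersections of the equivalence relations; joins are meets of
-- upper bounds, as there are finitely many trees.

open import Defs
open import Data.Empty using (⊥)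
open import Data.Fin using (zero; suc)
open import Data.Fin.Properties using () renaming (_≟_ to _≟ᶠ_)
open import Data.Fin.Subset using (Subset; ∁) renaming (⊤ to full)
open import Data.Bool using (true; false)
open import Data.List using (List; []; _∷_; _++_; [_]; applyUpTo; cartesianProductWith; concat; concatMap; filter; foldr; length; lookup; map; upTo)
open import Data.List.Extrema.Nat using (max; min≤⊤; v≤min⁺; ⊥≤max; xs≤max; max≤v⁺; argmax-sel)
open import Data.List.Membership.Propositional using (_∈_; _∉_; lose; find)
open import Data.List.Membership.Propositional.Properties
open import Data.List.NonEmpty using (toList; _∷_; head)
open import Data.List.Properties using (++-assoc; ++-identityʳ; map-++; concat-++; ∷-injective)
open import Data.List.Relation.Binary.Permutation.Propositional using (_↭_; ↭-sym; ↭-trans; ↭-refl; ↭-reflexive; ↭⇒↭ₛ; prep)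
open import Data.List.Relation.Binary.Permutation.Propositional.Properties using (∈-resp-↭; shift; shifts; ++⁺; merge-↭)
import Data.List.Relation.Binary.Permutation.Setoid.Properties as Perm
open import Data.List.Relation.Binary.Sublist.Propositional using (_⊆_; []; _∷_; _∷ʳ_; ⊆-refl; from∈)
open import Data.List.Relation.Binary.Sublist.Propositional.Properties using (All-resp-⊆; Any-resp-⊆) renaming (++⁺ to ⊆-++⁺; ++⁺ˡ to ⊆-++⁺ˡ; ++⁺ʳ to ⊆-++⁺ʳ)
open import Data.List.Relation.Unary.All as All using (All; []; _∷_; all?)
import Data.List.Relation.Unary.All.Properties as All
open import Data.List.Relation.Unary.AllPairs using (AllPairs; []; _∷_)
import Data.List.Relation.Unary.AllPairs.Properties as AllPairs
open import Data.List.Relation.Unary.Any as Any using (Any; here; there; any?; index)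
open import Data.List.Relation.Unary.Any.Properties as Any using (lookup-index)
open import Data.List.Relation.Unary.Linked as Linked using (Linked; []; [-]; _∷_)
open import Data.List.Relation.Unary.Linked.Properties using (Linked⇒All; Linked⇒AllPairs; AllPairs⇒Linked)
open import Data.List.Relation.Unary.Unique.Propositional using (Unique)
open import Data.List.Relation.Unary.Unique.Propositional.Properties using (applyUpTo⁺₁)
open import Data.Nat
open import Data.List.Membership.DecPropositional _≟_ using (_∈?_)
open import Data.Nat.Properties
open import Data.Product using (∃; ∃₂; ∃-syntax; _×_; _,_; proj₁; proj₂; swap; uncurry)
open import Data.Sum as Sum using (_⊎_; inj₁; inj₂; [_,_]′)
open import Data.Unit using (⊤; tt)
open import Data.Vec using ([]; _∷_)
open import Function using (_∘_; id; _on_; mk⇔; Equivalence)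
open import Level using (0ℓ)
open import Relation.Binary using (Rel; Decidable; Symmetric; Transitive; Asymmetric; IsPartialOrder)
import Relation.Binary.Construct.On as On
open import Relation.Binary.Construct.Closure.ReflexiveTransitive using (Star; ε; _◅_; _◅◅_; gmap)
open import Relation.Binary.Lattice.Structures using (IsLattice; IsMeetSemilattice)
open import Relation.Binary.Morphism.Structures using (IsOrderIsomorphism)
open import Relation.Binary.PropositionalEquality using (_≡_; _≢_; refl; sym; trans; cong; cong₂; subst; subst₂; setoid; isEquivalence)
open import Relation.Nullary using (¬_; Dec; does; yes; no; contradiction)
open import Relation.Nullary.Decidable using (map′; _×-dec_; _⊎-dec_; _→-dec_; dec-true; dec-false)
open import Relation.Unary using () renaming (Decidable to Decidable₁)

-- A chain of covers between two 312-avoiding permutations may pass through arbitrary elements of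
-- NCCP(n), so the two directions are proved in different generality. Monotonicity is shown for all
-- increasing trees, where right chains are followed edge by edge: splitting at `𝔫` cuts left edges
-- only, and gluing interleaves two chains. The converse stays among preorder trees and uses only
-- the simplest rotations: `S` is full, so that a whole subtree moves, and `𝔫ₐ` is the root of the
-- subtree reached by the recursion. The side condition on `𝔫ₐ` then holds because in preorder no
-- smaller label is right to `𝔫`. The obstacle in the converse is the shape of the tree: the chain
-- headed by `m′` can be moved only as part of a subtree. Refinement supplies it. In `u` the labels
-- between `k` and `m′` are separated from those from `m′` on, so in the left subtree of `t` the
-- labels from `m′` on form one full subtree hanging by a left edge.

private variable
  k m e n x y z : ℕ
  l r s t u     : Tree
  A             : Set
  xs ys         : List A
  B C           : Block
  π ρ           : BlockSeq

-- Right chains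

spine : Tree → List ℕ
spine leaf         = []
spine (node _ x r) = x ∷ spine r

-- Only the chain through the root needs `onSpine`; every other chain lies inside one subtree. `inr`
-- also covers the part of the root's chain below the root, so that chains of a subtree lift without
-- a case distinction.
data Same : Tree → ℕ → ℕ → Set where
  onSpine : x ∈ spine t → y ∈ spine t → Same t x y
  inl     : Same l x y → Same (node l z r) x y
  inr     : Same r x y → Same (node l z r) x y

infix 4 _≼_

_≼_ : Tree → Tree → Set
t ≼ u = ∀ {x y} → Same t x y → Same u x y

infix 4 _∈ᵀ_

data _∈ᵀ_ : ℕ → Tree → Set where
  root    : x ∈ᵀ node l x r
  inLeft  : x ∈ᵀ l → x ∈ᵀ node l z r
  inRight : x ∈ᵀ r → x ∈ᵀ node l z r

∈ᵀ⇒∈ : x ∈ᵀ t → x ∈ inorder t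
∈ᵀ⇒∈ {t = node l _ _} root         = ∈-++⁺ʳ (inorder l) (here refl)
∈ᵀ⇒∈ {t = node l _ _} (inLeft x∈)  = ∈-++⁺ˡ (∈ᵀ⇒∈ x∈)
∈ᵀ⇒∈ {t = node l _ _} (inRight x∈) = ∈-++⁺ʳ (inorder l) (there (∈ᵀ⇒∈ x∈))

∈⇒∈ᵀ : ∀ t → x ∈ inorder t → x ∈ᵀ t
∈⇒∈ᵀ (node l _ r) x∈ with ∈-++⁻ (inorder l) x∈
... | inj₁ x∈l         = inLeft (∈⇒∈ᵀ l x∈l)
... | inj₂ (here refl) = root
... | inj₂ (there x∈r) = inRight (∈⇒∈ᵀ r x∈r)

spine⇒∈ᵀ : ∀ t → x ∈ spine t → x ∈ᵀ t
spine⇒∈ᵀ (node _ _ _) (here refl) = root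
spine⇒∈ᵀ (node _ _ r) (there x∈)  = inRight (spine⇒∈ᵀ r x∈)

Same-sym : Same t x y → Same t y x
Same-sym (onSpine x∈ y∈) = onSpine y∈ x∈
Same-sym (inl s)         = inl (Same-sym s)
Same-sym (inr s)         = inr (Same-sym s)

Same⇒∈ᵀ : Same t x y → x ∈ᵀ t
Same⇒∈ᵀ {t} (onSpine x∈ _) = spine⇒∈ᵀ t x∈
Same⇒∈ᵀ (inl s)            = inLeft (Same⇒∈ᵀ s)
Same⇒∈ᵀ (inr s)            = inRight (Same⇒∈ᵀ s)

Same-refl : x ∈ᵀ t → Same t x x
Same-refl root         = onSpine (here refl) (here refl)
Same-refl (inLeft x∈)  = inl (Same-refl x∈)
Same-refl (inRight x∈) = inr (Same-refl x∈)

-- Trees labelled in preorder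

-- The labels are `k`, ..., `e - 1` in preorder. With half-open intervals the subtrees fit together
-- at `m`, which is the root of the right subtree if there is one and `e` otherwise.
data Pre : ℕ → ℕ → Tree → Set where
  leaf : Pre k k leaf
  node : Pre (suc k) m l → Pre m e r → Pre k e (node l k r)

Pre-≤ : Pre k e t → k ≤ e
Pre-≤ leaf       = ≤-refl
Pre-≤ (node p q) = ≤-trans (n≤1+n _) (≤-trans (Pre-≤ p) (Pre-≤ q))

Pre-bounds : Pre k e t → x ∈ᵀ t → k ≤ x × x < e
Pre-bounds (node p q) root         = ≤-refl , ≤-trans (Pre-≤ p) (Pre-≤ q)
Pre-bounds (node p q) (inLeft x∈)  =
  let a , b = Pre-bounds p x∈ in <⇒≤ a , <-≤-trans b (Pre-≤ q)
Pre-bounds (node p q) (inRight x∈) =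
  let a , b = Pre-bounds q x∈ in <⇒≤ (≤-trans (Pre-≤ p) a) , b

Pre-∈ : Pre k e t → k ≤ x → x < e → x ∈ᵀ t
Pre-∈ leaf k≤x x<k = contradiction x<k (≤⇒≯ k≤x)
Pre-∈ {x = x} (node {k} {m} p q) k≤x x<e with k ≟ x | x <? m
... | yes refl | _       = root
... | no k≢x   | yes x<m = inLeft (Pre-∈ p (≤∧≢⇒< k≤x k≢x) x<m)
... | no _     | no x≮m  = inRight (Pre-∈ q (≮⇒≥ x≮m) x<e)

spine-≥ : Pre k e t → x ∈ spine t → k ≤ x
spine-≥ {t = t} p x∈ = proj₁ (Pre-bounds p (spine⇒∈ᵀ t x∈))

Same-≥ : Pre k e t → Same t x y → k ≤ x
Same-≥ p s = proj₁ (Pre-bounds p (Same⇒∈ᵀ s))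

Same-< : Pre k e t → Same t x y → x < e
Same-< p s = proj₂ (Pre-bounds p (Same⇒∈ᵀ s))

module _ (p : Pre (suc k) m l) (q : Pre m e r) where

  -- Inversion of `Same`: the label ranges of the root, of `l` and of `r` are disjoint, so bounds on
  -- the labels decide which constructor was used.
  Same-rootˡ : Same (node l k r) k y → y ∈ k ∷ spine r
  Same-rootˡ (onSpine _ y∈) = y∈
  Same-rootˡ (inl s)      = contradiction (Same-≥ p s) (n≮n _)
  Same-rootˡ (inr s)      = contradiction (≤-trans (Pre-≤ p) (Same-≥ q s)) (n≮n _)

  Same-nodeˡ : k < x → x < m → Same (node l k r) x y → Same l x y
  Same-nodeˡ k<x x<m (onSpine (here refl) _) = contradiction k<x (n≮n _)
  Same-nodeˡ k<x x<m (onSpine (there x∈) _)  = contradiction x<m (≤⇒≯ (spine-≥ q x∈))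
  Same-nodeˡ k<x x<m (inl s)               = s
  Same-nodeˡ k<x x<m (inr s)               = contradiction x<m (≤⇒≯ (Same-≥ q s))

  Same-nodeʳ : m ≤ x → m ≤ y → Same (node l k r) x y → Same r x y
  Same-nodeʳ m≤x m≤y (onSpine (here refl) _)           = contradiction (Pre-≤ p) (≤⇒≯ m≤x)
  Same-nodeʳ m≤x m≤y (onSpine (there _) (here refl))   = contradiction (Pre-≤ p) (≤⇒≯ m≤y)
  Same-nodeʳ m≤x m≤y (onSpine (there x∈) (there y∈))   = onSpine x∈ y∈
  Same-nodeʳ m≤x m≤y (inl s) = contradiction (Same-< p s) (≤⇒≯ m≤x)
  Same-nodeʳ m≤x m≤y (inr s) = s

  spine-right : m ≤ x → x ∈ k ∷ spine r → x ∈ spine r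
  spine-right m≤x (here refl) = contradiction (Pre-≤ p) (≤⇒≯ m≤x)
  spine-right m≤x (there x∈)  = x∈

root-∈-spine : Pre k e t → k < e → k ∈ spine t
root-∈-spine leaf       k<k = contradiction k<k (n≮n _)
root-∈-spine (node _ _) _   = here refl

Same-root : Pre k e t → Same t k y → y ∈ spine t
Same-root leaf (onSpine () _)
Same-root (node p q) s = Same-rootˡ p q s

-- The chains of the left subtree stay strictly between `k` and `m`, while the root's chain jumps
-- over this range; hence a crossing can only occur within one subtree or with `a = k`.
Same-noncrossing : Pre k e t → ∀ {a b c d} → a < b → b < c → c < d →
                   Same t a c → Same t b d → Same t a b
Same-noncrossing leaf _ _ _ (onSpine () _) _
Same-noncrossing (node {k} {m} {r = r} p q) {a} {b} {c} {d} a<b b<c c<d = go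
  where
  m≤ : x ∈ k ∷ spine r → k < x → m ≤ x
  m≤ (here refl) k<k = contradiction k<k (n≮n _)
  m≤ (there x∈)  _   = spine-≥ q x∈
  go : Same _ a c → Same _ b d → Same _ a b
  go (onSpine a∈ c∈) (onSpine b∈ d∈) = onSpine a∈ b∈
  go (onSpine a∈ c∈) (inl bd) = contradiction (<-≤-trans c<d (<⇒≤ (Same-< p (Same-sym bd))))
    (≤⇒≯ (m≤ c∈ (<-trans (Same-≥ p bd) b<c)))
  go (onSpine (here refl) (here refl)) (inr bd) = contradiction (<-trans a<b b<c) (n≮n _)
  go (onSpine (there a∈) (here refl)) (inr bd) =
    contradiction (<-trans (<-trans a<b b<c) (≤-trans (Pre-≤ p) (spine-≥ q a∈))) (n≮n _)
  go (onSpine (there a∈) (there c∈)) (inr bd) = inr (Same-noncrossing q a<b b<c c<d (onSpine a∈ c∈) bd)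
  -- The chain of `k` continues at `m`, the root of `r`, which takes over the role of `a` there
  -- unless it is `b` itself.
  go (onSpine (here refl) (there c∈)) (inr bd) with m ≟ b
  ... | yes refl = onSpine (here refl) (there (root-∈-spine q (Same-< q bd)))
  ... | no m≢b = onSpine (here refl) (there (Same-root q (Same-noncrossing q m<b b<c c<d
                   (onSpine (root-∈-spine q (≤-trans m<b (<⇒≤ (Same-< q bd)))) c∈) bd)))
    where m<b = ≤∧≢⇒< (Same-≥ q bd) m≢b
  go (inl ac) (onSpine (here refl) _) = contradiction (<-trans a<b (Same-≥ p ac)) (n≮n _)
  go (inl ac) (onSpine (there b∈) _) = contradiction (<-trans b<c (Same-< p (Same-sym ac))) (≤⇒≯ (spine-≥ q b∈))
  go (inl ac) (inl bd) = inl (Same-noncrossing p a<b b<c c<d ac bd)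
  go (inl ac) (inr bd) = contradiction (<-trans b<c (Same-< p (Same-sym ac))) (≤⇒≯ (Same-≥ q bd))
  go (inr ac) (onSpine (here refl) _) = contradiction (<-trans a<b (≤-trans (Pre-≤ p) (Same-≥ q ac))) (n≮n _)
  go (inr ac) (onSpine (there b∈) (here refl)) =
    contradiction (<-trans (<-trans b<c c<d) (≤-trans (Pre-≤ p) (spine-≥ q b∈))) (n≮n _)
  go (inr ac) (onSpine (there b∈) (there d∈)) = inr (Same-noncrossing q a<b b<c c<d ac (onSpine b∈ d∈))
  go (inr ac) (inl bd) = contradiction (<-trans a<b (Same-< p bd)) (≤⇒≯ (Same-≥ q ac))
  go (inr ac) (inr bd) = inr (Same-noncrossing q a<b b<c c<d ac bd)

-- m and m′ are the labels that follow k in its right chains (e if there are none).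
next-≤ : ∀ {m′ l′ r′} → Pre (suc k) m l → Pre m e r → Pre (suc k) m′ l′ → Pre m′ e r′ →
         node l k r ≼ node l′ k r′ → m′ ≤ m
next-≤ p leaf p′ q′ _ = Pre-≤ q′
next-≤ p (node q₁ q₂) p′ q′ t≼u
  with Same-rootˡ p′ q′ (t≼u (onSpine (here refl) (there (here refl))))
... | here refl = contradiction (Pre-≤ p) (n≮n _)
... | there m∈  = spine-≥ q′ m∈

≼-left : ∀ {l′ r′} → Pre (suc k) m l → Pre (suc k) m l′ → Pre m e r′ →
         node l k r ≼ node l′ k r′ → l ≼ l′
≼-left p p′ q′ t≼u s = Same-nodeˡ p′ q′ (Same-≥ p s) (Same-< p s) (t≼u (inl s))

≼-right : ∀ {l′ r′} → Pre m e r → Pre (suc k) m l′ → Pre m e r′ →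
          node l k r ≼ node l′ k r′ → r ≼ r′
≼-right q p′ q′ t≼u s = Same-nodeʳ p′ q′ (Same-≥ q s) (Same-≥ q (Same-sym s)) (t≼u (inr s))

-- Mutual refinement forces the same `m` in both trees, hence the same label ranges for the
-- subtrees.
≼-antisym : Pre k e t → Pre k e u → t ≼ u → u ≼ t → t ≡ u
≼-antisym leaf leaf _ _ = refl
≼-antisym leaf (node p′ q′) _ _ = contradiction (≤-trans (Pre-≤ p′) (Pre-≤ q′)) (n≮n _)
≼-antisym (node p′ q′) leaf _ _ = contradiction (≤-trans (Pre-≤ p′) (Pre-≤ q′)) (n≮n _)
≼-antisym (node p q) (node p′ q′) t≼u u≼t
  with ≤-antisym (next-≤ p q p′ q′ t≼u) (next-≤ p′ q′ p q u≼t)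
... | refl = cong₂ (λ l r → node l _ r)
  (≼-antisym p p′ (≼-left p p′ q′ t≼u) (≼-left p′ p q u≼t))
  (≼-antisym q q′ (≼-right q p′ q′ t≼u) (≼-right q′ p q u≼t))

-- Noncrossing equivalences

-- Noncrossing is put positively: two crossing pairs belong to one class. In this form the condition
-- passes to intersections. Reflexivity is asked only on the interval, as `Same` relates only labels
-- of the tree.
record IsNoncrossing (k e : ℕ) (R : ℕ → ℕ → Set) : Set where
  field
    dec         : Decidable R
    reflexive   : k ≤ x → x < e → R x x
    symmetric   : Symmetric R
    transitive  : Transitive R
    noncrossing : ∀ {a b c d} → a < b → b < c → c < d → R a c → R b d → R a b

-- A search through the `d` numbers from `k` on. The value `e` signals failure, which matches the
-- role of `m` in `Pre` when the right subtree is empty.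
least : ∀ {P : ℕ → Set} → (∀ x → Dec (P x)) → ∀ d {k e} → k + d ≡ e →
        ∃[ m ] (k ≤ m × m ≤ e × (m < e → P m) × (∀ {x} → k ≤ x → x < m → ¬ P x))
least P? zero {k} refl = k , ≤-refl , m≤m+n k 0 ,
  (λ k<k → contradiction k<k (≤⇒≯ (≤-reflexive (+-identityʳ k)))) ,
  λ k≤x x<k _ → contradiction x<k (≤⇒≯ k≤x)
least {P} P? (suc d) {k} refl with P? k
... | yes pk = k , ≤-refl , m≤m+n k (suc d) , (λ _ → pk) , λ k≤x x<k _ → contradiction x<k (≤⇒≯ k≤x)
... | no ¬pk with least {P} P? d {suc k} (sym (+-suc k d))
... | m , k<m , m≤e , pm , below = m , <⇒≤ k<m , m≤e , pm , below′
  where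
  below′ : ∀ {x} → k ≤ x → x < m → ¬ P x
  below′ {x} k≤x x<m with k ≟ x
  ... | yes refl = ¬pk
  ... | no k≢x = below (≤∧≢⇒< k≤x k≢x) x<m

module _ {n₀ n₁ : ℕ} {R : ℕ → ℕ → Set} (nc : IsNoncrossing n₀ n₁ R) where
  open IsNoncrossing nc

  -- Take for `m` the next element after `k` in the class of `k` and cut there: noncrossing
  -- separates the labels between `k` and `m` from all later ones, so both sides can be treated
  -- recursively. `d` bounds the length of the interval and drives the recursion.
  noncrossing⇒tree : ∀ d {k e} → n₀ ≤ k → e ≤ n₁ → k ≤ e → e ≤ k + d → ∃[ t ] (Pre k e t ×
    (∀ {x y} → Same t x y → R x y) ×
    (∀ {x y} → k ≤ x → x ≤ y → y < e → R x y → Same t x y))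
  noncrossing⇒tree d {k} {e} n₀≤k e≤n₁ k≤e e≤k+d with k ≟ e
  noncrossing⇒tree d {k} n₀≤k e≤n₁ k≤e e≤k+d | yes refl = leaf , leaf ,
    (λ { (onSpine () _) }) , λ k≤x x≤y y<k → contradiction (≤-trans k≤x x≤y) (<⇒≱ y<k)
  noncrossing⇒tree zero {k} n₀≤k e≤n₁ k≤e e≤k+d | no k≢e =
    contradiction (≤-antisym k≤e (≤-trans e≤k+d (≤-reflexive (+-identityʳ k)))) k≢e
  noncrossing⇒tree (suc d) {k} {e} n₀≤k e≤n₁ k≤e e≤k+d | no k≢e
    with k<e ← ≤∧≢⇒< k≤e k≢e
    with m , k<m , m≤e , Rkm , ¬Rkx ← least (dec k) (e ∸ suc k) (m+[n∸m]≡n k<e)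
    with e≤k+d ← ≤-trans e≤k+d (≤-reflexive (+-suc k d))
    with l , p , Same⇒Rˡ , R⇒Sameˡ ← noncrossing⇒tree d {suc k} {m}
      (m≤n⇒m≤1+n n₀≤k) (≤-trans m≤e e≤n₁) k<m (≤-trans m≤e e≤k+d)
    with r , q , Same⇒Rʳ , R⇒Sameʳ ← noncrossing⇒tree d {m} {e}
      (≤-trans n₀≤k (<⇒≤ k<m)) e≤n₁ m≤e (≤-trans e≤k+d (+-monoˡ-≤ d k<m))
    = node l k r , node p q , sound , complete
    where
    fromRoot : x ∈ k ∷ spine r → R k x
    fromRoot (here refl) = reflexive n₀≤k (<-≤-trans k<e e≤n₁)
    fromRoot (there x∈)  = transitive (Rkm m<e) (Same⇒Rʳ (onSpine (root-∈-spine q m<e) x∈))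
      where m<e = ≤-<-trans (spine-≥ q x∈) (proj₂ (Pre-bounds q (spine⇒∈ᵀ r x∈)))
    sound : Same (node l k r) x y → R x y
    sound (onSpine x∈ y∈) = transitive (symmetric (fromRoot x∈)) (fromRoot y∈)
    sound (inl s) = Same⇒Rˡ s
    sound (inr s) = Same⇒Rʳ s
    complete : k ≤ x → x ≤ y → y < e → R x y → Same (node l k r) x y
    complete {x} {y} k≤x x≤y y<e Rxy with k ≟ x | m ≤? x | m ≤? y
    ... | _ | yes m≤x | _ = inr (R⇒Sameʳ m≤x x≤y y<e Rxy)
    ... | no k≢x | no _ | no m≰y = inl (R⇒Sameˡ (≤∧≢⇒< k≤x k≢x) x≤y (≰⇒> m≰y) Rxy)
    ... | yes refl | no _ | yes m≤y = onSpine (here refl) (there (Same-root q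
            (R⇒Sameʳ ≤-refl m≤y y<e (transitive (symmetric (Rkm (≤-<-trans m≤y y<e))) Rxy))))
    ... | yes refl | no _ | no m≰y with k ≟ y
    ...   | yes refl = onSpine (here refl) (here refl)
    ...   | no k≢y = contradiction Rxy (¬Rkx (≤∧≢⇒< x≤y k≢y) (≰⇒> m≰y))
    -- Here `k < x < m ≤ y`. Then `x` would be in the class of `k`, by transitivity if `y = m` and
    -- by noncrossing otherwise, against the choice of `m`.
    complete {x} {y} k≤x x≤y y<e Rxy | no k≢x | no m≰x | yes m≤y with m ≟ y
    ...   | yes refl = contradiction (transitive (Rkm y<e) (symmetric Rxy))
                         (¬Rkx (≤∧≢⇒< k≤x k≢x) (≰⇒> m≰x))
    ...   | no m≢y = contradiction (noncrossing k<x (≰⇒> m≰x) (≤∧≢⇒< m≤y m≢y)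
                         (Rkm (≤-<-trans m≤y y<e)) Rxy)
                         (¬Rkx k<x (≰⇒> m≰x))
      where k<x = ≤∧≢⇒< k≤x k≢x

  treeOf : n₀ ≤ n₁ → ∃[ t ] (Pre n₀ n₁ t × (∀ {x y} → Same t x y → R x y) ×
    (∀ {x y} → n₀ ≤ x → x < n₁ → n₀ ≤ y → y < n₁ → R x y → Same t x y))
  treeOf n₀≤n₁
    with t , p , sound , complete ← noncrossing⇒tree n₁ ≤-refl ≤-refl n₀≤n₁ (m≤n+m n₁ n₀)
    = t , p , sound , λ {x} {y} a b c d Rxy → case (≤-total x y) a b c d Rxy
    where
    case : ∀ {x y} → x ≤ y ⊎ y ≤ x → n₀ ≤ x → x < n₁ → n₀ ≤ y → y < n₁ → R x y → Same t x y
    case (inj₁ x≤y) a b c d Rxy = complete a x≤y d Rxy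
    case (inj₂ y≤x) a b c d Rxy = Same-sym (complete c y≤x b (symmetric Rxy))

-- Decidability of refinement

Same? : ∀ t → Decidable (Same t)
Same? leaf x y = no λ { (onSpine () _) }
Same? (node l z r) x y =
  map′ (λ { (inj₁ (a , b)) → onSpine a b ; (inj₂ (inj₁ s)) → inl s ; (inj₂ (inj₂ s)) → inr s })
       (λ { (onSpine a b) → inj₁ (a , b) ; (inl s) → inj₂ (inj₁ s) ; (inr s) → inj₂ (inj₂ s) })
       (((x ∈? spine (node l z r)) ×-dec (y ∈? spine (node l z r)))
         ⊎-dec (Same? l x y ⊎-dec Same? r x y))

-- `Same t` relates only labels of `t`, so finitely many pairs have to be tested.
_≼?_ : Decidable _≼_
t ≼? u = map′
  (λ ps s → All.lookup (All.lookup ps (∈ᵀ⇒∈ (Same⇒∈ᵀ s))) (∈ᵀ⇒∈ (Same⇒∈ᵀ (Same-sym s))) s)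
  (λ t≼u → All.tabulate λ _ → All.tabulate λ _ → t≼u)
  (all? (λ x → all? (λ y → Same? t x y →-dec Same? u x y) (inorder t)) (inorder t))

-- Lists without repetitions, sorted lists and the range [n]

Unique-++⁻ʳ : ∀ (xs : List A) → Unique (xs ++ ys) → Unique ys
Unique-++⁻ʳ []       u       = u
Unique-++⁻ʳ (_ ∷ xs) (_ ∷ u) = Unique-++⁻ʳ xs u

Unique-++⁻ˡ : ∀ (xs : List A) → Unique (xs ++ ys) → Unique xs
Unique-++⁻ˡ []       _        = []
Unique-++⁻ˡ (_ ∷ xs) (x≢ ∷ u) = All.++⁻ˡ xs x≢ ∷ Unique-++⁻ˡ xs u

Unique-disjoint : ∀ {x : A} → Unique (xs ++ ys) → x ∈ xs → x ∉ ys
Unique-disjoint {xs = _ ∷ xs} (x≢ ∷ _) (here refl) x∈ys = All.lookup x≢ (∈-++⁺ʳ xs x∈ys) refl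
Unique-disjoint               (_ ∷ u)  (there x∈)  x∈ys = Unique-disjoint u x∈ x∈ys

sorted-head-≡ : ∀ {R : A → A → Set} {x y} → Asymmetric R → All (R x) xs → All (R y) ys →
                x ∈ y ∷ ys → y ∈ x ∷ xs → x ≡ y
sorted-head-≡ asym px py (here x≡y) _          = x≡y
sorted-head-≡ asym px py (there _)  (here y≡x) = sym y≡x
sorted-head-≡ asym px py (there x∈) (there y∈) =
  contradiction (All.lookup px y∈) (asym (All.lookup py x∈))

sorted-≡ : ∀ {R : A → A → Set} → Asymmetric R → AllPairs R xs → AllPairs R ys →
           (∀ {z} → z ∈ xs → z ∈ ys) → (∀ {z} → z ∈ ys → z ∈ xs) → xs ≡ ys
sorted-≡ asym [] [] _ _ = refl
sorted-≡ asym [] (_ ∷ _) _ g = contradiction (g (here refl)) λ ()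
sorted-≡ asym (_ ∷ _) [] f _ = contradiction (f (here refl)) λ ()
sorted-≡ {xs = x ∷ xs} {y ∷ ys} {R} asym (px ∷ pxs) (py ∷ pys) f g
  with refl ← sorted-head-≡ asym px py (f (here refl)) (g (here refl))
  = cong (x ∷_) (sorted-≡ asym pxs pys (strengthen px f) (strengthen py g))
  where
  strengthen : ∀ {x us vs} → All (R x) us → (∀ {z} → z ∈ x ∷ us → z ∈ x ∷ vs) → ∀ {z} → z ∈ us → z ∈ vs
  strengthen pu h z∈ with h (there z∈)
  ... | here refl = contradiction (All.lookup pu z∈) (λ r → asym r r)
  ... | there z∈′ = z∈′

∈-range : x ∈ ⟦1⋯ n ⟧ → 1 ≤ x × x < suc n
∈-range x∈ with i , i<n , refl ← ∈-applyUpTo⁻ suc x∈ = s≤s z≤n , s≤s i<n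

range-∈ : 1 ≤ x → x < suc n → x ∈ ⟦1⋯ n ⟧
range-∈ {suc x} _ (s≤s x<n) = ∈-applyUpTo⁺ suc x<n

range-unique : ∀ n → Unique ⟦1⋯ n ⟧
range-unique n = applyUpTo⁺₁ suc n λ i<j _ 1+i≡1+j → <⇒≢ i<j (suc-injective 1+i≡1+j)

Unique-resp-↭ : xs ↭ ys → Unique xs → Unique ys
Unique-resp-↭ p = Perm.Unique-resp-↭ (setoid _) (↭⇒↭ₛ p)

↭-range-unique : xs ↭ ⟦1⋯ n ⟧ → Unique xs
↭-range-unique {n = n} p = Unique-resp-↭ (↭-sym p) (range-unique n)

-- Blocks

SameBlock : BlockSeq → ℕ → ℕ → Set
SameBlock π x y = Any (λ B → x ∈ toList B × y ∈ toList B) π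

infix 4 _≼ᵇ_

_≼ᵇ_ : BlockSeq → BlockSeq → Set
π ≼ᵇ ρ = ∀ {x y} → SameBlock π x y → SameBlock ρ x y

block-∈-word : B ∈ π → x ∈ toList B → x ∈ word π
block-∈-word B∈π x∈B = ∈-concatMap⁺ toList (lose B∈π x∈B)

word-∈-block : ∀ π → x ∈ word π → ∃[ B ] (B ∈ π × x ∈ toList B)
word-∈-block π x∈ = find (∈-concatMap⁻ toList {π} x∈)

index-unique : Unique (word π) → ∀ i j →
               x ∈ toList (lookup π i) → x ∈ toList (lookup π j) → i ≡ j
index-unique {_ ∷ _} u zero    zero    x∈ x∈′ = refl
index-unique {B ∷ π} u zero    (suc j) x∈ x∈′ =
  contradiction (block-∈-word {π = π} (∈-lookup j) x∈′) (Unique-disjoint u x∈)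
index-unique {B ∷ π} u (suc i) zero    x∈ x∈′ =
  contradiction (block-∈-word {π = π} (∈-lookup i) x∈) (Unique-disjoint u x∈′)
index-unique {B ∷ π} u (suc i) (suc j) x∈ x∈′ =
  cong suc (index-unique {π} (Unique-++⁻ʳ (toList B) u) i j x∈ x∈′)

block-unique : Unique (word π) → B ∈ π → C ∈ π → x ∈ toList B → x ∈ toList C → B ≡ C
block-unique {π} u B∈ C∈ x∈B x∈C = trans (lookup-index B∈) (trans
  (cong (lookup π) (index-unique {π} u (index B∈) (index C∈)
    (subst (λ D → _ ∈ toList D) (lookup-index B∈) x∈B)
    (subst (λ D → _ ∈ toList D) (lookup-index C∈) x∈C)))
  (sym (lookup-index C∈)))

SameBlock-sym : Symmetric (SameBlock π)
SameBlock-sym = Any.map swap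

SameBlock-∈ : Unique (word π) → B ∈ π → x ∈ toList B → SameBlock π x y → y ∈ toList B
SameBlock-∈ {π} u B∈ x∈B s with _ , C∈ , x∈C , y∈C ← find s
  with refl ← block-unique {π} u B∈ C∈ x∈B x∈C = y∈C

SameBlock-trans : Unique (word π) → Transitive (SameBlock π)
SameBlock-trans {π} u s s′ with _ , B∈ , x∈B , y∈B ← find s =
  lose B∈ (x∈B , SameBlock-∈ {π} u B∈ y∈B s′)

SameBlock? : ∀ π → Decidable (SameBlock π)
SameBlock? π x y = any? (λ B → (x ∈? toList B) ×-dec (y ∈? toList B)) π

SameBlock-refl : ∀ π → x ∈ word π → SameBlock π x x
SameBlock-refl π x∈ with _ , B∈ , x∈B ← word-∈-block π x∈ = lose B∈ (x∈B , x∈B)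

SameBlock⇒∈ : SameBlock π x y → x ∈ word π
SameBlock⇒∈ {π} s with _ , B∈ , x∈B , _ ← find s = block-∈-word {π = π} B∈ x∈B

module _ (isNCCP : IsNCCP n π) where
  open IsNCCP isNCCP

  word-unique : Unique (word π)
  word-unique = ↭-range-unique once

  word⇒bounds : x ∈ word π → 1 ≤ x × x < suc n
  word⇒bounds x∈ = ∈-range (∈-resp-↭ once x∈)

  bounds⇒word : 1 ≤ x → x < suc n → x ∈ word π
  bounds⇒word 1≤x x<1+n = ∈-resp-↭ (↭-sym once) (range-∈ 1≤x x<1+n)

NCP-noncrossing : IsNCP n π → IsNoncrossing 1 (suc n) (SameBlock π)
NCP-noncrossing {n} {π} p = record
  { dec         = SameBlock? π
  ; reflexive   = λ 1≤x x≤n → SameBlock-refl π (bounds⇒word isNCCP 1≤x x≤n)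
  ; symmetric   = SameBlock-sym
  ; transitive  = SameBlock-trans {π} unique
  ; noncrossing = nc
  }
  where
  open IsNCP p
  unique : Unique (word π)
  unique = word-unique isNCCP
  nc : ∀ {a b c d} → a < b → b < c → c < d → SameBlock π a c → SameBlock π b d → SameBlock π a b
  nc a<b b<c c<d ac bd with lookup-index ac | lookup-index bd | index ac ≟ᶠ index bd
  ... | a∈ , c∈ | b∈ , d∈ | no i≢j  = contradiction (a∈ , c∈ , b∈ , d∈) (nonCrossing a<b b<c c<d i≢j)
  ... | a∈ , c∈ | b∈ , d∈ | yes i≡j = lose (∈-lookup (index ac))
    (a∈ , subst (λ i → _ ∈ toList (lookup π i)) (sym i≡j) b∈)

-- Refinement is inclusion of equivalences

module _ {P : A → Set} (P? : Decidable₁ P) where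

  subsetOf : ∀ xs → Subset (length xs)
  subsetOf []       = []
  subsetOf (x ∷ xs) = does (P? x) ∷ subsetOf xs

  select-subsetOf : ∀ xs → select xs (subsetOf xs) ≡ filter P? xs
  select-subsetOf [] = refl
  select-subsetOf (x ∷ xs) with P? x
  ... | yes _ = cong (x ∷_) (select-subsetOf xs)
  ... | no  _ = select-subsetOf xs

select-∈ : ∀ xs (S : Subset (length xs)) {x : A} → x ∈ select xs S → x ∈ xs
select-∈ []       []          ()
select-∈ (x ∷ xs) (true  ∷ S) (here refl) = here refl
select-∈ (x ∷ xs) (true  ∷ S) (there y∈)  = there (select-∈ xs S y∈)
select-∈ (x ∷ xs) (false ∷ S) y∈          = there (select-∈ xs S y∈)

module _ (p : IsNCCP n π) (q : IsNCCP n ρ) where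

  Refines⇒≼ᵇ : Refines π ρ → π ≼ᵇ ρ
  Refines⇒≼ᵇ ref {x} {y} s
    with B , B∈ , x∈B , y∈B ← find s
    with C , C∈ , x∈C ← word-∈-block ρ (uncurry (bounds⇒word q) (word⇒bounds p (block-∈-word {π = π} B∈ x∈B)))
    with U , C⇔ ← ref C∈
    with D , D∈ , x∈D ← word-∈-block (select π U) (Equivalence.to (C⇔ x) x∈C)
    with refl ← block-unique {π} (word-unique p) B∈ (select-∈ π U D∈) x∈B x∈D
    = lose C∈ (x∈C , Equivalence.from (C⇔ y) (block-∈-word {π = select π U} D∈ y∈B))

  ≼ᵇ⇒Refines : π ≼ᵇ ρ → Refines π ρ
  ≼ᵇ⇒Refines π≼ρ {B} B∈ = subsetOf P? π , λ x → mk⇔ (to x) (from x)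
    where
    -- A block of `π` that meets `B` is contained in `B`, so testing its head suffices.
    P? : Decidable₁ (λ C → head C ∈ toList B)
    P? C = head C ∈? toList B
    to : ∀ x → x ∈ toList B → x ∈ word (select π (subsetOf P? π))
    to x x∈B rewrite select-subsetOf P? π
      with C , C∈ , x∈C ← word-∈-block π (uncurry (bounds⇒word p) (word⇒bounds q (block-∈-word {π = ρ} B∈ x∈B)))
      = block-∈-word {π = filter P? π} (∈-filter⁺ P? C∈
          (SameBlock-∈ {ρ} (word-unique q) B∈ x∈B (π≼ρ (lose C∈ (x∈C , here refl))))) x∈C
    from : ∀ x → x ∈ word (select π (subsetOf P? π)) → x ∈ toList B
    from x x∈ rewrite select-subsetOf P? π
      with C , C∈ , x∈C ← word-∈-block (filter P? π) x∈
      with C∈π , PC ← ∈-filter⁻ P? {xs = π} C∈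
      = SameBlock-∈ {ρ} (word-unique q) B∈ PC (π≼ρ (lose C∈π (here refl , x∈C)))

toList-injective : toList B ≡ toList C → B ≡ C
toList-injective {_ ∷ _} {_ ∷ _} refl = refl

-- The equivalence relation determines the sequence because `canonical` fixes the order of the
-- blocks and `increasing` the order within each; `sorted-≡` is applied at both levels.
NCP-≡ : IsNCP n π → IsNCP n ρ → π ≼ᵇ ρ → ρ ≼ᵇ π → π ≡ ρ
NCP-≡ {n} p q π≼ρ ρ≼π = sorted-≡ (λ {B} {C} → <-asym) (sorted p) (sorted q) (incl p q π≼ρ ρ≼π) (incl q p ρ≼π π≼ρ)
  where
  sorted : IsNCP n π → AllPairs (λ B C → minᵇ C < minᵇ B) π
  sorted = Linked⇒AllPairs (λ a b → <-trans b a) ∘ IsNCP.canonical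
  incl : IsNCP n π → IsNCP n ρ → π ≼ᵇ ρ → ρ ≼ᵇ π → B ∈ π → B ∈ ρ
  incl {π} {ρ} {B} p q π≼ρ ρ≼π B∈
    with p′ ← IsNCP.isNCCP p | q′ ← IsNCP.isNCCP q
    with C , C∈ , h∈C ← word-∈-block ρ (uncurry (bounds⇒word q′) (word⇒bounds p′ (block-∈-word {π = π} B∈ (here refl))))
    = subst (_∈ ρ) (toList-injective (sorted-≡ <-asym
        (Linked⇒AllPairs <-trans (All.lookup (IsNCCP.increasing q′) C∈))
        (Linked⇒AllPairs <-trans (All.lookup (IsNCCP.increasing p′) B∈))
        (λ z∈ → SameBlock-∈ {π} (word-unique p′) B∈ (here refl) (ρ≼π (lose C∈ (h∈C , z∈))))
        (λ z∈ → SameBlock-∈ {ρ} (word-unique q′) C∈ h∈C (π≼ρ (lose B∈ (here refl , z∈)))))) C∈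

-- Words of preorder trees

interval : ℕ → ℕ → List ℕ
interval k zero    = []
interval k (suc d) = k ∷ interval (suc k) d

interval-+ : ∀ k c d → interval k (c + d) ≡ interval k c ++ interval (k + c) d
interval-+ k zero    d rewrite +-identityʳ k = refl
interval-+ k (suc c) d rewrite +-suc k c = cong (k ∷_) (interval-+ (suc k) c d)

interval-applyUpTo : ∀ f k n → (∀ i → f i ≡ k + i) → applyUpTo f n ≡ interval k n
interval-applyUpTo f k zero    _  = refl
interval-applyUpTo f k (suc n) f≗ = cong₂ _∷_ (trans (f≗ 0) (+-identityʳ k))
  (interval-applyUpTo (f ∘ suc) (suc k) n λ i → trans (f≗ (suc i)) (+-suc k i))

Pre⇒interval : Pre k e t → ∃[ d ] (k + d ≡ e × inorder t ↭ interval k d)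
Pre⇒interval {k} leaf = 0 , +-identityʳ k , ↭-refl
Pre⇒interval (node {k} {l = l} {r = r} p q)
  with c , refl , σ ← Pre⇒interval p
  with d , refl , τ ← Pre⇒interval q
  = suc (c + d)
  , trans (+-suc k (c + d)) (cong suc (sym (+-assoc k c d)))
  , ↭-trans (shift k (inorder l) (inorder r))
      (prep k (↭-trans (++⁺ σ τ) (↭-reflexive (sym (interval-+ (suc k) c d)))))

Pre⇒↭ : Pre 1 (suc n) t → inorder t ↭ ⟦1⋯ n ⟧
Pre⇒↭ {n} p with d , refl , σ ← Pre⇒interval p =
  ↭-trans σ (↭-reflexive (sym (interval-applyUpTo suc 1 n λ _ → refl)))

-- The noncrossing partition into right chains

word-++ : ∀ π ρ → word (π ++ ρ) ≡ word π ++ word ρ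
word-++ π ρ = trans (cong concat (map-++ toList π ρ)) (sym (concat-++ (map toList π) (map toList ρ)))

-- `innerChains` leaves out the chain through the root, because the one of `r` is prolonged by the
-- parent. Listing `r` before `l` and the root's chain last makes the minima decrease, as
-- `canonical` demands.
innerChains chains : Tree → BlockSeq
innerChains leaf           = []
innerChains (node l _ r)   = innerChains r ++ chains l
chains leaf                = []
chains t@(node _ x r)      = innerChains t ++ [ x ∷ spine r ]

inner⊆chains : ∀ t → B ∈ innerChains t → B ∈ chains t
inner⊆chains (node l x r) = ∈-++⁺ˡ

word-chains-spine : ∀ t → word (chains t) ≡ word (innerChains t) ++ spine t
word-chains-spine leaf           = refl
word-chains-spine t@(node _ x r) = trans (word-++ (innerChains t) _)
  (cong (λ xs → word (innerChains t) ++ x ∷ xs) (++-identityʳ (spine r)))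

word-inner : ∀ t → word (innerChains t) ++ spine t ↭ inorder t
word-inner leaf         = ↭-refl
word-inner (node l x r) = ↭-trans
  (↭-reflexive (trans (cong (_++ x ∷ spine r) (word-++ (innerChains r) (chains l)))
                      (++-assoc (word (innerChains r)) _ _)))
  (↭-trans (shifts (word (innerChains r)) (word (chains l)))
  (++⁺ (↭-trans (↭-reflexive (word-chains-spine l)) (word-inner l))
       (↭-trans (shift x (word (innerChains r)) (spine r)) (prep x (word-inner r)))))

word-chains : ∀ t → word (chains t) ↭ inorder t
word-chains t = ↭-trans (↭-reflexive (word-chains-spine t)) (word-inner t)

Same⇒inner    : Same t x y → x ∈ spine t × y ∈ spine t ⊎ SameBlock (innerChains t) x y
Same⇒SameBlock : Same t x y → SameBlock (chains t) x y
Same⇒inner (onSpine x∈ y∈) = inj₁ (x∈ , y∈)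
Same⇒inner {node _ _ r} (inl s) = inj₂ (Any.++⁺ʳ (innerChains r) (Same⇒SameBlock s))
Same⇒inner (inr s) with Same⇒inner s
... | inj₁ (x∈ , y∈) = inj₁ (there x∈ , there y∈)
... | inj₂ s′        = inj₂ (Any.++⁺ˡ s′)
Same⇒SameBlock {leaf} (onSpine () _)
Same⇒SameBlock {t@(node _ _ _)} s with Same⇒inner s
... | inj₁ x,y = Any.++⁺ʳ (innerChains t) (here x,y)
... | inj₂ s′  = Any.++⁺ˡ s′

inner⇒Same     : ∀ t → SameBlock (innerChains t) x y → Same t x y
SameBlock⇒Same : ∀ t → SameBlock (chains t) x y → Same t x y
inner⇒Same (node l _ r) s =
  [ inr ∘ inner⇒Same r , inl ∘ SameBlock⇒Same l ]′ (Any.++⁻ (innerChains r) s)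
SameBlock⇒Same t@(node _ _ _) s =
  [ inner⇒Same t , (λ { (here (x∈ , y∈)) → onSpine x∈ y∈ }) ]′ (Any.++⁻ (innerChains t) s)

-- Transitivity rests on distinct labels. It is taken over from blocks, where a label determines the
-- block that contains it.
Same-trans : Unique (inorder t) → Same t x y → Same t y z → Same t x z
Same-trans {t} u s s′ = SameBlock⇒Same t
  (SameBlock-trans {chains t} (Unique-resp-↭ (↭-sym (word-chains t)) u) (Same⇒SameBlock s) (Same⇒SameBlock s′))

spine-increasing : Pre k e t → Linked _<_ (spine t)
spine-increasing leaf                     = []
spine-increasing (node _ leaf)            = [-]
spine-increasing (node p q@(node _ _))    = Pre-≤ p ∷ spine-increasing q

chains-increasing : Pre k e t → All (λ B → Linked _<_ (toList B)) (chains t)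
inner-increasing  : Pre k e t → All (λ B → Linked _<_ (toList B)) (innerChains t)
chains-increasing leaf         = []
chains-increasing p@(node _ _) = All.++⁺ (inner-increasing p) (spine-increasing p ∷ [])
inner-increasing leaf       = []
inner-increasing (node p q) = All.++⁺ (inner-increasing q) (chains-increasing p)

minᵇ-head : Linked _<_ (toList B) → minᵇ B ≡ head B
minᵇ-head {x ∷ []}     _          = refl
minᵇ-head {x ∷ y ∷ ys} (x<y ∷ lk) = ≤-antisym (min≤⊤ x (y ∷ ys))
  (v≤min⁺ ≤-refl (All.map <⇒≤ (Linked⇒All <-trans x<y lk)))

chains-min : Pre k e t → B ∈ chains t → k ≤ minᵇ B × minᵇ B < e
chains-min {t = t} {B} p B∈ rewrite minᵇ-head {B} (All.lookup (chains-increasing p) B∈) =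
  Pre-bounds p (∈⇒∈ᵀ t (∈-resp-↭ (word-chains t) (block-∈-word {π = chains t} B∈ (here refl))))

chains-sorted : Pre k e t → AllPairs (λ B C → minᵇ C < minᵇ B) (chains t)
inner-sorted  : Pre k e t → AllPairs (λ B C → minᵇ C < minᵇ B) (innerChains t)
chains-sorted leaf = []
chains-sorted {t = t@(node l k r)} pq@(node p q) = AllPairs.++⁺ (inner-sorted pq) ([] ∷ [])
  (All.tabulate λ {B} B∈ → subst (_< minᵇ B) (sym (minᵇ-head {k ∷ spine r} (spine-increasing pq))) (above B∈) ∷ [])
  where
  above : B ∈ innerChains t → k < minᵇ B
  above B∈ with ∈-++⁻ (innerChains r) B∈
  ... | inj₁ B∈r = ≤-trans (Pre-≤ p) (proj₁ (chains-min q (inner⊆chains r B∈r)))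
  ... | inj₂ B∈l = proj₁ (chains-min p B∈l)
inner-sorted leaf       = []
inner-sorted {t = node l k r} (node p q) = AllPairs.++⁺ (inner-sorted q) (chains-sorted p)
  (All.tabulate λ B∈ → All.tabulate λ C∈ →
    <-≤-trans (proj₂ (chains-min p C∈)) (proj₁ (chains-min q (inner⊆chains r B∈))))

chains-isNCP : Pre 1 (suc n) t → IsNCP n (chains t)
chains-isNCP {n} {t} p = record
  { isNCCP      = record
    { once       = once
    ; increasing = chains-increasing p
    -- Descents follow from the order of the minima, since the maximum of a block is at least its
    -- minimum.
    ; descents   = Linked.map (λ { {x ∷ xs} {C} C<B →
        <-≤-trans C<B (≤-trans (min≤⊤ x xs) (⊥≤max x xs)) }) canonical
    }
  ; nonCrossing = λ {a} {b} {c} {d} {i} {j} a<b b<c c<d i≢j (a∈ , c∈ , b∈ , d∈) →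
      let same : ∀ {x y} i → x ∈ _ → y ∈ _ → Same t x y
          same i x∈ y∈ = SameBlock⇒Same t (lose (∈-lookup {xs = chains t} i) (x∈ , y∈))
          ab = Same-noncrossing p a<b b<c c<d (same i a∈ c∈) (same j b∈ d∈)
      in i≢j (index-unique {chains t} unique i j
           (SameBlock-∈ {chains t} unique (∈-lookup i) a∈ (Same⇒SameBlock ab)) b∈)
  ; canonical   = canonical
  }
  where
  once : word (chains t) ↭ ⟦1⋯ n ⟧
  once = ↭-trans (word-chains t) (Pre⇒↭ p)
  unique : Unique (word (chains t))
  unique = ↭-range-unique once
  canonical : Canonical (chains t)
  canonical = AllPairs⇒Linked (chains-sorted p)

-- Joins from finite meets, and transport of lattices

module _ {_≈_ _⊴_ : Rel A 0ℓ} {_∧_} (isMeet : IsMeetSemilattice {A = A} _≈_ _⊴_ _∧_)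
         (_⊴?_ : Decidable _⊴_) (top : A) (⊴-top : ∀ a → a ⊴ top)
         (universe : List A) (complete : ∀ a → a ∈ universe) where
  open IsMeetSemilattice isMeet renaming (refl to ⊴-refl; trans to ⊴-trans; infimum to inf)

  private
    ⋀ : List A → A
    ⋀ = foldr _∧_ top

    ⋀-lower : ∀ {a as} → a ∈ as → ⋀ as ⊴ a
    ⋀-lower {as = b ∷ bs} (here refl) = x∧y≤x b (⋀ bs)
    ⋀-lower {as = b ∷ bs} (there a∈)  = ⊴-trans (x∧y≤y b (⋀ bs)) (⋀-lower a∈)

    ⋀-greatest : ∀ {a as} → (∀ {b} → b ∈ as → a ⊴ b) → a ⊴ ⋀ as
    ⋀-greatest {as = []}    _     = ⊴-top _
    ⋀-greatest {as = _ ∷ _} lower = ∧-greatest (lower (here refl)) (⋀-greatest (lower ∘ there))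

    above? : ∀ a b c → Dec (a ⊴ c × b ⊴ c)
    above? a b c = (a ⊴? c) ×-dec (b ⊴? c)

    _∨_ : A → A → A
    a ∨ b = ⋀ (filter (above? a b) universe)

  finiteMeet⇒lattice : IsLatticeOrder _≈_ _⊴_
  finiteMeet⇒lattice = _∨_ , _∧_ , record
    { isPartialOrder = isPartialOrder
    ; supremum = λ a b →
        ⋀-greatest (λ {c} c∈ → proj₁ (proj₂ (∈-filter⁻ (above? a b) {xs = universe} c∈))) ,
        ⋀-greatest (λ {c} c∈ → proj₂ (proj₂ (∈-filter⁻ (above? a b) {xs = universe} c∈))) ,
        λ c a⊴c b⊴c → ⋀-lower (∈-filter⁺ (above? a b) (complete c) (a⊴c , b⊴c))
    ; infimum = inf
    }

module _ {A B : Set} {_≈₁_ _≤₁_ : Rel A 0ℓ} {_≈₂_ _≤₂_ : Rel B 0ℓ}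
         (to : A → B) (from : B → A) (to∘from : ∀ b → to (from b) ≈₂ b)
         (≈⇒ : ∀ {x y} → x ≈₁ y → to x ≈₂ to y) (≈⇐ : ∀ {x y} → to x ≈₂ to y → x ≈₁ y)
         (≤⇒ : ∀ {x y} → x ≤₁ y → to x ≤₂ to y) (≤⇐ : ∀ {x y} → to x ≤₂ to y → x ≤₁ y) where

  transportLattice : IsLatticeOrder _≈₂_ _≤₂_ → IsLatticeOrder _≈₁_ _≤₁_
  transportLattice (_∨_ , _∧_ , L) =
    (λ x y → from (to x ∨ to y)) , (λ x y → from (to x ∧ to y)) , record
    { isPartialOrder = record
      { isPreorder = record
        { isEquivalence = record
          { refl  = ≈⇐ L.Eq.refl
          ; sym   = λ p → ≈⇐ (L.Eq.sym (≈⇒ p))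
          ; trans = λ p q → ≈⇐ (L.Eq.trans (≈⇒ p) (≈⇒ q))
          }
        ; reflexive = λ p → ≤⇐ (L.reflexive (≈⇒ p))
        ; trans     = λ p q → ≤⇐ (L.trans (≤⇒ p) (≤⇒ q))
        }
      ; antisym = λ p q → ≈⇐ (L.antisym (≤⇒ p) (≤⇒ q))
      }
    ; supremum = λ x y →
        ≤⇐ (L.≤-respʳ-≈ (L.Eq.sym (to∘from _)) (L.x≤x∨y (to x) (to y))) ,
        ≤⇐ (L.≤-respʳ-≈ (L.Eq.sym (to∘from _)) (L.y≤x∨y (to x) (to y))) ,
        λ z p q → ≤⇐ (L.≤-respˡ-≈ (L.Eq.sym (to∘from _)) (L.∨-least (≤⇒ p) (≤⇒ q)))
    ; infimum = λ x y →
        ≤⇐ (L.≤-respˡ-≈ (L.Eq.sym (to∘from _)) (L.x∧y≤x (to x) (to y))) ,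
        ≤⇐ (L.≤-respˡ-≈ (L.Eq.sym (to∘from _)) (L.x∧y≤y (to x) (to y))) ,
        λ z p q → ≤⇐ (L.≤-respʳ-≈ (L.Eq.sym (to∘from _)) (L.∧-greatest (≤⇒ p) (≤⇒ q)))
    }
    where module L = IsLattice L

-- The lattice of preorder trees

PreTree : ℕ → Set
PreTree n = ∃[ t ] Pre 1 (suc n) t

leaves : ∀ k e → List (∃[ t ] Pre k e t)
leaves k e with k ≟ e
... | yes refl = [ leaf , leaf ]
... | no _     = []

preTrees : ℕ → ∀ k e → List (∃[ t ] Pre k e t)
preTrees zero    k e = leaves k e
preTrees (suc h) k e = leaves k e ++ concatMap
  (λ m → cartesianProductWith (λ (l , p) (r , q) → node l k r , node p q)
           (preTrees h (suc k) m) (preTrees h m e))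
  (upTo (suc e))

∈-leaves : ∀ k → (leaf , leaf) ∈ leaves k k
∈-leaves k with k ≟ k
... | yes refl = here refl
... | no k≢k   = contradiction refl k≢k

-- Each subtree misses at least the root's label, so the number of labels bounds the depth.
-- Membership concerns the pair with its derivation because these pairs are the elements of
-- `PreTree`.
∈-preTrees : ∀ h (p : Pre k e t) → e ≤ k + h → (t , p) ∈ preTrees h k e
∈-preTrees zero    leaf _ = ∈-leaves _
∈-preTrees (suc h) leaf _ = ∈-++⁺ˡ (∈-leaves _)
∈-preTrees {k} zero (node p q) e≤k =
  contradiction (≤-trans (≤-trans (Pre-≤ p) (Pre-≤ q)) (≤-trans e≤k (≤-reflexive (+-identityʳ k)))) (n≮n _)
∈-preTrees {k} {e} (suc h) (node p q) e≤k+h = ∈-++⁺ʳ (leaves k e) (∈-concatMap⁺ _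
  (lose (∈-upTo⁺ (s≤s (Pre-≤ q))) (∈-cartesianProductWith⁺ _
    (∈-preTrees h p (≤-trans (Pre-≤ q) e≤k+h′))
    (∈-preTrees h q (≤-trans e≤k+h′ (+-monoˡ-≤ h (Pre-≤ p)))))))
  where
  e≤k+h′ : e ≤ suc k + h
  e≤k+h′ = ≤-trans e≤k+h (≤-reflexive (+-suc k h))

Pre-unique : Pre 1 (suc n) t → Unique (inorder t)
Pre-unique p = ↭-range-unique (Pre⇒↭ p)

≈ᵗ-isPartialOrder : ∀ n → IsPartialOrder {A = PreTree n} (_≡_ on proj₁) (_≼_ on proj₁)
≈ᵗ-isPartialOrder n = record
  { isPreorder = record
    { isEquivalence = On.isEquivalence proj₁ isEquivalence
    ; reflexive     = λ { refl s → s }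
    ; trans         = λ t≼u u≼v s → u≼v (t≼u s)
    }
  ; antisym = λ { {_ , p} {_ , q} → ≼-antisym p q }
  }

intersection : (a b : PreTree n) →
  IsNoncrossing 1 (suc n) (λ x y → Same (proj₁ a) x y × Same (proj₁ b) x y)
intersection (t , p) (u , q) = record
  { dec         = λ x y → Same? t x y ×-dec Same? u x y
  ; reflexive   = λ k≤x x<e → Same-refl (Pre-∈ p k≤x x<e) , Same-refl (Pre-∈ q k≤x x<e)
  ; symmetric   = λ (s , s′) → Same-sym s , Same-sym s′
  ; transitive  = λ (s , s′) (v , v′) →
      Same-trans (Pre-unique p) s v , Same-trans (Pre-unique q) s′ v′
  ; noncrossing = λ a<b b<c c<d (s , s′) (v , v′) →
      Same-noncrossing p a<b b<c c<d s v , Same-noncrossing q a<b b<c c<d s′ v′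
  }

-- The partition with one block; its tree is the top element, the value of the empty meet.
total : IsNoncrossing 1 (suc n) (λ _ _ → ⊤)
total = record { dec = λ _ _ → yes tt }

_∧ᵗ_ : PreTree n → PreTree n → PreTree n
a ∧ᵗ b = let t , p , _ = treeOf (intersection a b) (s≤s z≤n) in t , p

∧ᵗ-isMeetSemilattice : ∀ n → IsMeetSemilattice {A = PreTree n} (_≡_ on proj₁) (_≼_ on proj₁) _∧ᵗ_
∧ᵗ-isMeetSemilattice n = record
  { isPartialOrder = ≈ᵗ-isPartialOrder n
  ; infimum = λ a b → let _ , _ , sound , complete = treeOf (intersection a b) (s≤s z≤n) in
      (λ s → proj₁ (sound s)) , (λ s → proj₂ (sound s)) , λ (_ , q) c≼a c≼b s →
        complete (Same-≥ q s) (Same-< q s) (Same-≥ q (Same-sym s)) (Same-< q (Same-sym s)) (c≼a s , c≼b s)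
  }

PreTree-lattice : ∀ n → IsLatticeOrder {A = PreTree n} (_≡_ on proj₁) (_≼_ on proj₁)
PreTree-lattice n with t , p , _ , complete ← treeOf (total {n}) (s≤s z≤n) =
  finiteMeet⇒lattice (∧ᵗ-isMeetSemilattice n) (λ (t , _) (u , _) → t ≼? u) (t , p)
    (λ (_ , q) s → complete (Same-≥ q s) (Same-< q s) (Same-≥ q (Same-sym s)) (Same-< q (Same-sym s)) tt)
    (preTrees n 1 (suc n)) (λ (_ , q) → ∈-preTrees n q ≤-refl)

-- Noncrossing partitions as preorder trees

NCP⇒PreTree : (π : NCP n) → ∃[ t ] (Pre 1 (suc n) t × chains t ≡ proj₁ π)
NCP⇒PreTree {n} (π , isNCP)
  with t , p , sound , complete ← treeOf (NCP-noncrossing isNCP) (s≤s z≤n)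
  = t , p , NCP-≡ (chains-isNCP p) isNCP
    (λ s → sound (SameBlock⇒Same t s))
    (λ s → Same⇒SameBlock (uncurry (uncurry complete (bounds s)) (bounds (SameBlock-sym s)) s))
  where
  bounds : SameBlock π x y → 1 ≤ x × x < suc n
  bounds s = word⇒bounds (IsNCP.isNCCP isNCP) (SameBlock⇒∈ {π} s)

≼⇒≼ᵇ : t ≼ u → chains t ≼ᵇ chains u
≼⇒≼ᵇ {t} t≼u s = Same⇒SameBlock (t≼u (SameBlock⇒Same t s))

≼ᵇ⇒≼ : ∀ u → chains t ≼ᵇ chains u → t ≼ u
≼ᵇ⇒≼ u t≼u s = SameBlock⇒Same u (t≼u (Same⇒SameBlock s))

chains-injective : Pre k e t → Pre k e u → chains t ≡ chains u → t ≡ u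
chains-injective {t = t} {u} p q eq = ≼-antisym p q
  (λ s → SameBlock⇒Same u (subst (λ π → SameBlock π _ _) eq (Same⇒SameBlock s)))
  (λ s → SameBlock⇒Same t (subst (λ π → SameBlock π _ _) (sym eq) (Same⇒SameBlock s)))

-- Ascending runs

cons : ℕ → BlockSeq → BlockSeq
cons x []      = [ x ∷ [] ]
cons x (B ∷ π) with x <? head B
... | yes _ = (x ∷ toList B) ∷ π
... | no  _ = (x ∷ []) ∷ B ∷ π

-- Recovers a partition from its permutation by placing the slashes at the descents.
runs : List ℕ → BlockSeq
runs = foldr cons []

word-runs : ∀ w → word (runs w) ≡ w
word-runs []      = refl
word-runs (x ∷ w) = trans (word-cons (runs w)) (cong (x ∷_) (word-runs w))
  where
  word-cons : ∀ π → word (cons x π) ≡ x ∷ word π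
  word-cons []      = refl
  word-cons (B ∷ π) with x <? head B
  ... | yes _ = refl
  ... | no _  = refl

runs-increasing : ∀ w → All (λ B → Linked _<_ (toList B)) (runs w)
runs-increasing []      = []
runs-increasing (x ∷ w) = increasing (runs-increasing w)
  where
  increasing : All (λ B → Linked _<_ (toList B)) π → All (λ B → Linked _<_ (toList B)) (cons x π)
  increasing [] = [-] ∷ []
  increasing {B ∷ π} (lk ∷ lks) with x <? head B
  ... | yes x<B = (x<B ∷ lk) ∷ lks
  ... | no _    = [-] ∷ lk ∷ lks

Descents : BlockSeq → Set
Descents = Linked (λ B C → maxᵇ B > minᵇ C)

maxᵇ-cons-≥ : ∀ x y ys → maxᵇ (y ∷ ys) ≤ maxᵇ (x ∷ y ∷ ys)
maxᵇ-cons-≥ x y ys = max≤v⁺ (All.head (xs≤max x (y ∷ ys))) (All.tail (xs≤max x (y ∷ ys)))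

maxᵇ-cons-≤ : ∀ {x y} ys → x < y → maxᵇ (x ∷ y ∷ ys) ≤ maxᵇ (y ∷ ys)
maxᵇ-cons-≤ {x} {y} ys x<y = max≤v⁺ (≤-trans (<⇒≤ x<y) (⊥≤max y ys)) (⊥≤max y ys ∷ xs≤max y ys)

Descents-resp : maxᵇ B ≤ maxᵇ C → Descents (B ∷ π) → Descents (C ∷ π)
Descents-resp B≤C [-]       = [-]
Descents-resp B≤C (d ∷ ds)  = <-≤-trans d B≤C ∷ ds

runs-descents : ∀ w → Unique w → Descents (runs w)
runs-descents []      _         = []
runs-descents (x ∷ w) (x≢ ∷ u) =
  descents (subst (All (x ≢_)) (sym (word-runs w)) x≢) (runs-increasing w) (runs-descents w u)
  where
  descents : All (x ≢_) (word π) → All (λ B → Linked _<_ (toList B)) π → Descents π → Descents (cons x π)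
  descents {[]}            _           _         _  = [-]
  descents {(y ∷ ys) ∷ π} (x≢y ∷ _) (lk ∷ _) ds with x <? y
  ... | yes _  = Descents-resp (maxᵇ-cons-≥ x y ys) ds
  ... | no x≮y = subst (_< x) (sym (minᵇ-head lk)) (≤∧≢⇒< (≮⇒≥ x≮y) (x≢y ∘ sym)) ∷ ds

runs-isNCCP : ∀ {w} → w ↭ ⟦1⋯ n ⟧ → IsNCCP n (runs w)
runs-isNCCP {w = w} w↭ = record
  { once       = ↭-trans (↭-reflexive (word-runs w)) w↭
  ; increasing = runs-increasing w
  ; descents   = runs-descents w (↭-range-unique w↭)
  }

cons-< : x < y → ∀ {ys} → cons x ((y ∷ ys) ∷ π) ≡ (x ∷ y ∷ ys) ∷ π
cons-< {x} {y} x<y with x <? y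
... | yes _  = refl
... | no x≮y = contradiction x<y x≮y

cons-> : y < x → ∀ {ys} → cons x ((y ∷ ys) ∷ π) ≡ (x ∷ []) ∷ (y ∷ ys) ∷ π
cons-> {y} {x} y<x with x <? y
... | yes x<y = contradiction x<y (<-asym y<x)
... | no _    = refl

runs-word : All (λ B → Linked _<_ (toList B)) π → Descents π → runs (word π) ≡ π
runs-word {[]} _ _ = refl
runs-word {(x ∷ xs) ∷ π} = go x xs π
  where
  go : ∀ x xs π → All (λ B → Linked _<_ (toList B)) ((x ∷ xs) ∷ π) → Descents ((x ∷ xs) ∷ π) →
       runs (word ((x ∷ xs) ∷ π)) ≡ (x ∷ xs) ∷ π
  go x [] [] _ _ = refl
  go x [] ((y ∷ ys) ∷ π) (_ ∷ lk ∷ lks) (d ∷ ds) =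
    trans (cong (cons x) (go y ys π (lk ∷ lks) ds)) (cons-> (subst (_< x) (minᵇ-head lk) d))
  go x (y ∷ ys) π ((x<y ∷ lk) ∷ lks) ds =
    trans (cong (cons x) (go y ys π (lk ∷ lks) (Descents-resp (maxᵇ-cons-≤ ys x<y) ds))) (cons-< x<y)

NCCP-≡ : IsNCCP n π → runs (word π) ≡ π
NCCP-≡ p = runs-word (IsNCCP.increasing p) (IsNCCP.descents p)

-- Increasing trees are determined by their inorder words

-- The global form of the parent-child condition: it identifies the root as the minimum of the
-- inorder word.
data Heap : Tree → Set where
  leaf : Heap leaf
  node : All (x <_) (inorder l) → All (x <_) (inorder r) → Heap l → Heap r → Heap (node l x r)

increasing⇒Heap : ∀ t → (∀ {x y} → Child t y x → x < y) → Heap t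
increasing⇒Heap leaf         _   = leaf
increasing⇒Heap (node l x r) inc = node
  (above (λ { refl → inc (inj₁ (_ , _ , _ , here)) }) heapˡ)
  (above (λ { refl → inc (inj₂ (_ , _ , _ , here)) }) heapʳ) heapˡ heapʳ
  where
  heapˡ : Heap l
  heapˡ = increasing⇒Heap l λ
    { (inj₁ (a , b , c , s)) → inc (inj₁ (a , b , c , left s))
    ; (inj₂ (a , b , c , s)) → inc (inj₂ (a , b , c , left s)) }
  heapʳ : Heap r
  heapʳ = increasing⇒Heap r λ
    { (inj₁ (a , b , c , s)) → inc (inj₁ (a , b , c , right s))
    ; (inj₂ (a , b , c , s)) → inc (inj₂ (a , b , c , right s)) }
  above : ∀ {t} → (∀ {l y r} → t ≡ node l y r → x < y) → Heap t → All (x <_) (inorder t)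
  above x< leaf               = []
  above x< (node aˡ aʳ _ _) =
    All.++⁺ (All.map (<-trans (x< refl)) aˡ) (x< refl ∷ All.map (<-trans (x< refl)) aʳ)

labeled⇒Heap : IsLabeledTree n t → Heap t
labeled⇒Heap p = increasing⇒Heap _ (IsLabeledTree.increasing p)

-- If the two cuts were at different places, each of `x` and `y` would occur beside the other and be
-- larger than it.
split-at-min : ∀ as {bs cs ds} → as ++ x ∷ bs ≡ cs ++ y ∷ ds →
               All (x <_) as → All (x <_) bs → All (y <_) cs → All (y <_) ds →
               as ≡ cs × x ≡ y × bs ≡ ds
split-at-min []       {cs = []}     refl _ _ _ _ = refl , refl , refl
split-at-min []       {cs = c ∷ cs} refl _ x<bs (y<x ∷ _) _ =
  contradiction (All.lookup x<bs (∈-++⁺ʳ cs (here refl))) (<-asym y<x)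
split-at-min (a ∷ as) {cs = []}     refl (x<y ∷ _) _ _ y<ds =
  contradiction (All.lookup y<ds (∈-++⁺ʳ as (here refl))) (<-asym x<y)
split-at-min (a ∷ as) {cs = c ∷ cs} eq (_ ∷ x<as) x<bs (_ ∷ y<cs) y<ds
  with refl , eq′ ← ∷-injective eq
  with refl , refl , refl ← split-at-min as eq′ x<as x<bs y<cs y<ds = refl , refl , refl

node≢[] : ∀ l r → inorder (node l x r) ≢ []
node≢[] l r eq with () ← subst (_ ∈_) eq (∈ᵀ⇒∈ {t = node l _ r} root)

inorder-injective : Heap t → Heap u → inorder t ≡ inorder u → t ≡ u
inorder-injective leaf leaf _ = refl
inorder-injective leaf (node {l = l} {r = r} _ _ _ _) eq = contradiction (sym eq) (node≢[] l r)
inorder-injective (node {l = l} {r = r} _ _ _ _) leaf eq = contradiction eq (node≢[] l r)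
inorder-injective (node {l = l} a b h h′) (node a′ b′ g g′) eq
  with eqˡ , refl , eqʳ ← split-at-min (inorder l) eq a b a′ b′
  = cong₂ (λ l r → node l _ r) (inorder-injective h g eqˡ) (inorder-injective h′ g′ eqʳ)

-- Preorder labellings and 312-avoidance

⊑-Pre : s ⊑ t → Pre k e t → ∃₂ λ k′ e′ → Pre k′ e′ s
⊑-Pre here      p          = _ , _ , p
⊑-Pre (left s)  (node p q) = ⊑-Pre s p
⊑-Pre (right s) (node p q) = ⊑-Pre s q

Pre⇒labeled : Pre 1 (suc n) t → IsLabeledTree n t
Pre⇒labeled {n} {t} p = record { labels = Pre⇒↭ p ; increasing = inc }
  where
  inc : Child t y x → x < y
  inc (inj₁ (_ , _ , _ , s)) with _ , _ , node (node _ _) _ ← ⊑-Pre s p = ≤-refl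
  inc (inj₂ (_ , _ , _ , s)) with _ , _ , node q (node _ _) ← ⊑-Pre s p = Pre-≤ q

⊆-++⁻ : ∀ {ws} (as : List A) {bs} → ws ⊆ as ++ bs → ∃₂ λ us vs → ws ≡ us ++ vs × us ⊆ as × vs ⊆ bs
⊆-++⁻ []       τ = [] , _ , refl , [] , τ
⊆-++⁻ (a ∷ as) (_ ∷ʳ τ) with us , vs , eq , σ , ρ ← ⊆-++⁻ as τ = us , vs , eq , _ ∷ʳ σ , ρ
⊆-++⁻ (a ∷ as) (refl ∷ τ) with us , vs , refl , σ , ρ ← ⊆-++⁻ as τ = a ∷ us , vs , refl , refl ∷ σ , ρ

-- In a pattern 312, the entry `x` cannot be the root, which is minimal, and `x` in `l` with `z`
-- outside is impossible since the labels of `l` lie below those of `r`. So the whole pattern lies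
-- in one subtree.
Pre-avoids : Pre k e t → Avoids312 (inorder t)
Pre-avoids leaf ()
Pre-avoids {t = node l k r} (node {m = m} p q) {x} {y} {z} τ (y<z , z<x) = go (⊆-++⁻ (inorder l) τ)
  where
  x<m : ∀ {ws} → x ∷ ws ⊆ inorder l → x < m
  x<m σ = proj₂ (Pre-bounds p (∈⇒∈ᵀ l (Any-resp-⊆ σ (here refl))))
  k≤y : k ≤ y
  k≤y = proj₁ (Pre-bounds (node p q) (∈⇒∈ᵀ (node l k r) (Any-resp-⊆ τ (there (here refl)))))
  m≤z : z ∈ k ∷ inorder r → m ≤ z
  m≤z (here refl) = contradiction y<z (≤⇒≯ k≤y)
  m≤z (there z∈)  = proj₁ (Pre-bounds q (∈⇒∈ᵀ r z∈))
  go : (∃₂ λ us vs → x ∷ y ∷ z ∷ [] ≡ us ++ vs × us ⊆ inorder l × vs ⊆ k ∷ inorder r) → ⊥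
  go ([] , _ , refl , _ , _ ∷ʳ ρ)   = Pre-avoids q ρ (y<z , z<x)
  go ([] , _ , refl , _ , refl ∷ ρ) = contradiction (<-trans y<z z<x) (≤⇒≯ k≤y)
  go (_ ∷ [] , _ , refl , σ , ρ)     =
    contradiction (<-trans z<x (x<m σ)) (≤⇒≯ (m≤z (Any-resp-⊆ ρ (there (here refl)))))
  go (_ ∷ _ ∷ [] , _ , refl , σ , ρ) =
    contradiction (<-trans z<x (x<m σ)) (≤⇒≯ (m≤z (Any-resp-⊆ ρ (here refl))))
  go (_ ∷ _ ∷ _ ∷ [] , [] , refl , σ , _) = Pre-avoids p σ (y<z , z<x)

-- Cutting at the minimum k, avoidance of 312 forces the entries left of k to
-- be smaller than those right of k, so both sides are intervals again.
avoids⇒Pre : ∀ d {k e w} → k ≤ e → e ≤ k + d → Unique w →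
             (∀ {x} → x ∈ w → k ≤ x × x < e) → (∀ {x} → k ≤ x → x < e → x ∈ w) →
             Avoids312 w → ∃[ t ] (Pre k e t × inorder t ≡ w)
avoids⇒Pre d {k} {e} {w} k≤e e≤k+d uniq bound cover avoid with k ≟ e
avoids⇒Pre d {w = []}     _ _ _ _ _ _ | yes refl = leaf , leaf , refl
avoids⇒Pre d {w = x ∷ w} _ _ _ bound _ _ | yes refl =
  contradiction (proj₂ (bound (here refl))) (≤⇒≯ (proj₁ (bound (here refl))))
avoids⇒Pre zero {k} k≤e e≤k+d _ _ _ _ | no k≢e =
  contradiction (≤-antisym k≤e (≤-trans e≤k+d (≤-reflexive (+-identityʳ k)))) k≢e
avoids⇒Pre (suc d) {k} {e} {w} k≤e e≤k+d uniq bound cover avoid | no k≢e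
  with as , bs , refl ← ∈-∃++ (cover ≤-refl (≤∧≢⇒< k≤e k≢e))
  = node (proj₁ treeˡ) k (proj₁ treeʳ)
  , node (proj₁ (proj₂ treeˡ)) (proj₁ (proj₂ treeʳ))
  , cong₂ (λ us vs → us ++ k ∷ vs) (proj₂ (proj₂ treeˡ)) (proj₂ (proj₂ treeʳ))
  where
  k<e : k < e
  k<e = ≤∧≢⇒< k≤e k≢e
  top : ℕ
  -- The left subtree is to carry the labels from `suc k` to `top`; the default `k` makes this range
  -- empty when `as` is.
  top = max k as
  top∈ : top ≡ k ⊎ top ∈ as
  top∈ = argmax-sel id k as
  k∉as : k ∉ as
  k∉as k∈ = Unique-disjoint uniq k∈ (here refl)
  k∉bs : k ∉ bs
  k∉bs with k≢ ∷ _ ← Unique-++⁻ʳ as uniq = λ k∈ → All.lookup k≢ k∈ refl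
  boundˡ : x ∈ as → suc k ≤ x × x < suc top
  boundˡ x∈ = ≤∧≢⇒< (proj₁ (bound (∈-++⁺ˡ x∈))) (λ { refl → k∉as x∈ }) , s≤s (All.lookup (xs≤max k as) x∈)
  boundʳ : x ∈ bs → suc top ≤ x × x < e
  -- An entry `x` below `top` and right of `k` would form 312 with `top` and `k`.
  boundʳ {x} x∈ = ≰⇒> (λ x≤top → [ (λ top≡k → <⇒≱ k<x (≤-trans x≤top (≤-reflexive top≡k)))
                               , (λ t∈ → avoid (⊆-++⁺ (from∈ t∈) (refl ∷ from∈ x∈))
                                   (k<x , ≤∧≢⇒< x≤top λ { refl → Unique-disjoint uniq t∈ (there x∈) })) ]′ top∈)
              , proj₂ (bound (∈-++⁺ʳ as (there x∈)))
    where
    k<x : k < x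
    k<x = ≤∧≢⇒< (proj₁ (bound (∈-++⁺ʳ as (there x∈)))) λ { refl → k∉bs x∈ }
  top<e : top < e
  top<e = [ (λ top≡k → subst (_< e) (sym top≡k) k<e) , (λ t∈ → proj₂ (bound (∈-++⁺ˡ t∈))) ]′ top∈
  coverˡ : suc k ≤ x → x < suc top → x ∈ as
  coverˡ k<x (s≤s x≤top) with ∈-++⁻ as (cover (<⇒≤ k<x) (≤-<-trans x≤top top<e))
  ... | inj₁ x∈          = x∈
  ... | inj₂ (here refl) = contradiction k<x (n≮n _)
  ... | inj₂ (there x∈)  = contradiction (proj₁ (boundʳ x∈)) (≤⇒≯ x≤top)
  coverʳ : suc top ≤ x → x < e → x ∈ bs
  coverʳ top<x x<e with ∈-++⁻ as (cover (≤-trans (⊥≤max k as) (<⇒≤ top<x)) x<e)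
  ... | inj₁ x∈          = contradiction (proj₂ (boundˡ x∈)) (≤⇒≯ top<x)
  ... | inj₂ (here refl) = contradiction top<x (≤⇒≯ (⊥≤max k as))
  ... | inj₂ (there x∈)  = x∈
  e≤k+d′ : e ≤ suc k + d
  e≤k+d′ = ≤-trans e≤k+d (≤-reflexive (+-suc k d))
  treeˡ : ∃[ t ] (Pre (suc k) (suc top) t × inorder t ≡ as)
  treeˡ = avoids⇒Pre d (s≤s (⊥≤max k as)) (≤-trans top<e e≤k+d′) (Unique-++⁻ˡ as uniq)
            boundˡ coverˡ (avoid ∘ ⊆-++⁺ʳ (k ∷ bs))
  treeʳ : ∃[ t ] (Pre (suc top) e t × inorder t ≡ bs)
  treeʳ = avoids⇒Pre d top<e (≤-trans e≤k+d′ (+-monoˡ-≤ d (s≤s (⊥≤max k as))))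
            (Unique-++⁻ʳ [ k ] (Unique-++⁻ʳ as uniq)) boundʳ coverʳ
            (λ τ → avoid (⊆-++⁺ˡ as (k ∷ʳ τ)))

NCCP312⇒PreTree : (π : NCCP312 n) → ∃[ t ] (Pre 1 (suc n) t × inorder t ≡ word (proj₁ π))
NCCP312⇒PreTree {n} (π , p , avoid) =
  avoids⇒Pre n (s≤s z≤n) ≤-refl (word-unique p) (word⇒bounds p) (bounds⇒word p) avoid

-- Merging two right chains of a preorder tree

-- graft t s hangs s at the left of the last node of t in preorder.
graft : Tree → Tree → Tree
graft leaf                        s = s
graft (node l x leaf)             s = node (graft l s) x leaf
graft (node l x r@(node _ _ _))   s = node l x (graft r s)

append : Tree → Tree → Tree
append leaf         r = r
append (node l x s) r = node l x (append s r)

Pre-graft : Pre k m t → Pre m e s → Pre k e (graft t s)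
Pre-graft leaf                   q = q
Pre-graft (node p leaf)          q = node (Pre-graft p q) leaf
Pre-graft (node p p′@(node _ _)) q = node p (Pre-graft p′ q)

Pre-append : Pre k m s → Pre m e r → Pre k e (append s r)
Pre-append leaf        q = q
Pre-append (node p p′) q = node p (Pre-append p′ q)

-- In `rotate` the subtree rooted at `m` hangs by a left edge, so `m` heads a chain; this chain is
-- inserted between `k` and the rest of the chain of `k`. The label ranges in the premises keep the
-- result in preorder.
data Step : ℕ → ℕ → Tree → Tree → Set where
  rotate : ∀ {l₁ l₂ r₂ j} →
           Pre (suc k) m l₁ → Pre m j (node l₂ m r₂) → Pre j e r →
           Step k e (node (graft l₁ (node l₂ m r₂)) k r) (node l₁ k (append (node l₂ m r₂) r))
  stepˡ  : Step (suc k) m l s → Pre m e r → Step k e (node l k r) (node s k r)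
  stepʳ  : Pre (suc k) m l → Step m e r s → Step k e (node l k r) (node l k s)

Step⇒Preˡ : Step k e t u → Pre k e t
Step⇒Preˡ (rotate p p′ q) = node (Pre-graft p p′) q
Step⇒Preˡ (stepˡ s q)     = node (Step⇒Preˡ s) q
Step⇒Preˡ (stepʳ p s)     = node p (Step⇒Preˡ s)

Step⇒Preʳ : Step k e t u → Pre k e u
Step⇒Preʳ (rotate p p′ q) = node p (Pre-append p′ q)
Step⇒Preʳ (stepˡ s q)     = node (Step⇒Preʳ s) q
Step⇒Preʳ (stepʳ p s)     = node p (Step⇒Preʳ s)

spine-graft : ∀ t → x ∈ spine t → x ∈ spine (graft t s)
spine-graft (node _ _ leaf)           x∈           = x∈
spine-graft (node _ _ (node _ _ _))   (here x≡)    = here x≡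
spine-graft (node _ _ r@(node _ _ _)) (there x∈)   = there (spine-graft r x∈)

≼-graftˡ : ∀ t → t ≼ graft t s
≼-graftˡ t                         (onSpine x∈ y∈)  = onSpine (spine-graft t x∈) (spine-graft t y∈)
≼-graftˡ (node l _ leaf)           (inl s)          = inl (≼-graftˡ l s)
≼-graftˡ (node _ _ leaf)           (inr (onSpine () _))
≼-graftˡ (node _ _ (node _ _ _))   (inl s)          = inl s
≼-graftˡ (node _ _ r@(node _ _ _)) (inr s)          = inr (≼-graftˡ r s)

≼-graftʳ : ∀ t → s ≼ graft t s
≼-graftʳ leaf                      v = v
≼-graftʳ (node l _ leaf)           v = inl (≼-graftʳ l v)
≼-graftʳ (node _ _ r@(node _ _ _)) v = inr (≼-graftʳ r v)

spine-append : ∀ s → x ∈ spine (append s r) → x ∈ spine s ⊎ x ∈ spine r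
spine-append leaf         x∈          = inj₂ x∈
spine-append (node _ _ s) (here x≡)   = inj₁ (here x≡)
spine-append (node _ _ s) (there x∈)  = [ inj₁ ∘ there , inj₂ ]′ (spine-append s x∈)

Same-append : ∀ s → Same (append s r) x y →
  Same s x y ⊎ Same r x y ⊎ (x ∈ spine (append s r) × y ∈ spine (append s r))
Same-append leaf         v               = inj₂ (inj₁ v)
Same-append (node _ _ s) (onSpine x∈ y∈) = inj₂ (inj₂ (x∈ , y∈))
Same-append (node _ _ s) (inl v)         = inj₁ (inl v)
Same-append (node _ _ s) (inr v) with Same-append s v
... | inj₁ v′                = inj₁ (inr v′)
... | inj₂ (inj₁ v′)         = inj₂ (inj₁ v′)
... | inj₂ (inj₂ (x∈ , y∈)) = inj₂ (inj₂ (there x∈ , there y∈))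

-- No chain passes from below `m` to `m` or beyond, so the right child of a label below `m` is again
-- below `m`. The cut therefore moves into the right subtree if there is one, else into the left
-- one, and never falls on a right edge.
ungraft : Pre k e t → k ≤ m → m ≤ e → (∀ {x y} → Same t x y → x < m → y < m) →
          ∃₂ λ u s → t ≡ graft u s × Pre k m u × Pre m e s
ungraft leaf k≤m m≤k below with refl ← ≤-antisym k≤m m≤k = leaf , leaf , refl , leaf , leaf
ungraft {k} {e} {m = m} (node {m = j} {l = l} p q) k≤m m≤e below with k ≟ m | j <? e
... | yes refl | _ = leaf , _ , refl , leaf , node p q
... | no k≢m | yes j<e
  with j<m ← below (onSpine (here refl) (there (root-∈-spine q j<e))) (≤∧≢⇒< k≤m k≢m)
  with ungraft q (<⇒≤ j<m) m≤e (below ∘ inr)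
...   | leaf , _ , _ , leaf , _ = contradiction j<m (n≮n _)
...   | u@(node _ _ _) , s , eq , p₁ , p₂ = node l k u , s , cong (node l k) eq , node p p₁ , p₂
ungraft {k} {e} {m = m} (node {m = j} {l = l} p q) k≤m m≤e below | no k≢m | no j≮e with q
... | node q₁ q₂ = contradiction (≤-trans (Pre-≤ q₁) (Pre-≤ q₂)) j≮e
... | leaf with u , s , refl , p₁ , p₂ ← ungraft p (≤∧≢⇒< k≤m k≢m) m≤e (below ∘ inl)
  = node u k leaf , s , refl , node p₁ leaf , p₂

-- The recursion is structural in `u`: a rotation rebuilds both subtrees of `t`, but they are
-- compared with the subtrees `l′` and `r′` of `u`.
≼⇒Steps : Pre k e t → Pre k e u → t ≼ u → Star (Step k e) t u
≼⇒Steps leaf leaf _ = ε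
≼⇒Steps leaf (node p′ q′) _ = contradiction (≤-trans (Pre-≤ p′) (Pre-≤ q′)) (n≮n _)
≼⇒Steps (node p q) leaf _ = contradiction (≤-trans (Pre-≤ p) (Pre-≤ q)) (n≮n _)
≼⇒Steps {k} {e} {t = node l _ r} {u = node l′ _ r′} (node {m = m} p q) (node {m = m′} p′ q′) t≼u
  with m′ ≟ m
... | yes refl = gmap (λ l → node l k r) (λ s → stepˡ s q) (≼⇒Steps p p′ (≼-left p p′ q′ t≼u))
              ◅◅ gmap (λ r → node l′ k r) (stepʳ p′) (≼⇒Steps q q′ (≼-right q p′ q′ t≼u))
... | no m′≢m with m′<m ← ≤∧≢⇒< (next-≤ p q p′ q′ t≼u) m′≢m
  -- In `u` the labels strictly between `k` and `m′` fill `l′`, so a chain of `l` with a label below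
  -- `m′` stays below `m′`, as cutting requires.
  with ungraft p (Pre-≤ p′) (<⇒≤ m′<m) (λ s x<m′ →
         Same-< p′ (Same-sym (Same-nodeˡ p′ q′ (Same-≥ p s) x<m′ (t≼u (inl s)))))
... | _ , _ , _ , _ , leaf = contradiction m′<m (n≮n _)
... | l₁ , l₂ , refl , p₁ , p₂@(node _ _) =
  rotate p₁ p₂ q
  ◅ gmap (λ l → node l k (append l₂ r)) (λ s → stepˡ s (Pre-append p₂ q)) (≼⇒Steps p₁ p′ left-≼)
  ◅◅ gmap (λ r → node l′ k r) (stepʳ p′) (≼⇒Steps (Pre-append p₂ q) q′ right-≼)
  where
  left-≼ : l₁ ≼ l′
  left-≼ s = Same-nodeˡ p′ q′ (Same-≥ p₁ s) (Same-< p₁ s) (t≼u (inl (≼-graftˡ l₁ s)))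
  -- Both parts of the new chain lie on the chain of `k` in `u`: the part from `l₂` contains `m′`,
  -- the root of `r′`, and the part from `r` was already joined to `k` in `t`.
  onRight : x ∈ spine (append l₂ r) → x ∈ spine r′
  onRight x∈ with spine-append l₂ x∈
  ... | inj₁ x∈l₂ = Same-root q′ (Same-nodeʳ p′ q′ ≤-refl (spine-≥ p₂ x∈l₂)
                      (t≼u (inl (≼-graftʳ l₁ (onSpine (here refl) x∈l₂)))))
  ... | inj₂ x∈r  = spine-right p′ q′ (≤-trans (<⇒≤ m′<m) (spine-≥ q x∈r))
                      (Same-rootˡ p′ q′ (t≼u (onSpine (here refl) (there x∈r))))
  right-≼ : append l₂ r ≼ r′
  right-≼ s with Same-append l₂ s
  ... | inj₁ v = Same-nodeʳ p′ q′ (Same-≥ p₂ v) (Same-≥ p₂ (Same-sym v)) (t≼u (inl (≼-graftʳ l₁ v)))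
  ... | inj₂ (inj₁ v) = Same-nodeʳ p′ q′ (≤-trans (<⇒≤ m′<m) (Same-≥ q v))
                          (≤-trans (<⇒≤ m′<m) (Same-≥ q (Same-sym v))) (t≼u (inr v))
  ... | inj₂ (inj₂ (x∈ , y∈)) = onSpine (onRight x∈) (onRight y∈)

-- Merges as rotations

⊑⇒∈ᵀ : node l x r ⊑ t → x ∈ᵀ t
⊑⇒∈ᵀ here      = root
⊑⇒∈ᵀ (left s)  = inLeft (⊑⇒∈ᵀ s)
⊑⇒∈ᵀ (right s) = inRight (⊑⇒∈ᵀ s)

-- `replaceAt` searches both subtrees, so moving it into one of them requires that the label be
-- absent from the other.
replaceAt-∉ : ∀ t → ¬ x ∈ᵀ t → replaceAt x s t ≡ t
replaceAt-∉ leaf _ = refl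
replaceAt-∉ {x} (node l y r) x∉ with x ≟ y
... | yes refl = contradiction root x∉
... | no _     = cong₂ (λ l r → node l y r) (replaceAt-∉ l (x∉ ∘ inLeft)) (replaceAt-∉ r (x∉ ∘ inRight))

replaceAt-root : replaceAt x s (node l x r) ≡ s
replaceAt-root {x} with x ≟ x
... | yes _  = refl
... | no x≢x = contradiction refl x≢x

replaceAt-left : x ≢ z → ¬ x ∈ᵀ r → replaceAt x s (node l z r) ≡ node (replaceAt x s l) z r
replaceAt-left {x} {z} {r} x≢z x∉r with x ≟ z
... | yes x≡z = contradiction x≡z x≢z
... | no _    = cong (node _ z) (replaceAt-∉ r x∉r)

replaceAt-right : x ≢ z → ¬ x ∈ᵀ l → replaceAt x s (node l z r) ≡ node l z (replaceAt x s r)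
replaceAt-right {x} {z} {l} x≢z x∉l with x ≟ z
... | yes x≡z = contradiction x≡z x≢z
... | no _    = cong (λ l → node l z _) (replaceAt-∉ l x∉l)

module _ (p : Pre (suc k) m l) (q : Pre m e r) where

  replaceAt-Preˡ : ∀ t → x ∈ᵀ l → replaceAt x s (node t k r) ≡ node (replaceAt x s t) k r
  replaceAt-Preˡ _ x∈ = replaceAt-left (λ { refl → n≮n _ (proj₁ (Pre-bounds p x∈)) })
    λ x∈r → <⇒≱ (proj₂ (Pre-bounds p x∈)) (proj₁ (Pre-bounds q x∈r))

  replaceAt-Preʳ : ∀ t → x ∈ᵀ r → replaceAt x s (node l k t) ≡ node l k (replaceAt x s t)
  replaceAt-Preʳ _ x∈ = replaceAt-right (λ { refl → n≮n _ (≤-trans (Pre-≤ p) (proj₁ (Pre-bounds q x∈))) })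
    λ x∈l → <⇒≱ (proj₂ (Pre-bounds p x∈l)) (proj₁ (Pre-bounds q x∈))

Child-left : Child l y x → Child (node l z r) y x
Child-left (inj₁ (_ , _ , _ , s)) = inj₁ (_ , _ , _ , left s)
Child-left (inj₂ (_ , _ , _ , s)) = inj₂ (_ , _ , _ , left s)

Child-right : Child r y x → Child (node l z r) y x
Child-right (inj₁ (_ , _ , _ , s)) = inj₁ (_ , _ , _ , right s)
Child-right (inj₂ (_ , _ , _ , s)) = inj₂ (_ , _ , _ , right s)

OnPath-left : OnPath l x y → OnPath (node l z r) x y
OnPath-left = gmap id Child-left

OnPath-right : OnPath r x y → OnPath (node l z r) x y
OnPath-right = gmap id Child-right

OnPath-root : x ∈ᵀ node l y r → OnPath (node l y r) x y
OnPath-root root = ε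
OnPath-root {l = node _ _ _} (inLeft x∈)  = OnPath-left (OnPath-root x∈) ◅◅ inj₁ (_ , _ , _ , here) ◅ ε
OnPath-root {r = node _ _ _} (inRight x∈) = OnPath-right (OnPath-root x∈) ◅◅ inj₂ (_ , _ , _ , here) ◅ ε

-- The conditions of IsRotation, with only 𝔫ₐ ∈ LS(𝔫) left of the admissibility.
record IsLSRotation (L L′ : Tree) : Set where
  field
    {𝔫 𝔫₀ 𝔫ₐ}           : ℕ
    {lₙ rₙ r₀ lₐ rₐ}    : Tree
    𝔫-left : node (node lₙ 𝔫 rₙ) 𝔫₀ r₀ ⊑ L
    inLS   : LS L 𝔫 𝔫ₐ
    S      : Subset (length (leftSpine lₙ))
    at-𝔫ₐ  : node lₐ 𝔫ₐ rₐ ⊑ T₂ lₙ S 𝔫₀ r₀ L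
    glued  : L′ ≡ glue (T₁ lₙ S 𝔫 rₙ) 𝔫ₐ (node lₐ 𝔫ₐ rₐ) (T₂ lₙ S 𝔫₀ r₀ L)

LS⇒∈ᵀ : LS t x y → y ∈ᵀ t
LS⇒∈ᵀ (_ , _ , _ , _ , _ , _ , _ , s) = ⊑⇒∈ᵀ s

LS-left : LS l x y → LS (node l z r) x y
LS-left (path , y≢x , _ , path′ , _ , _ , _ , s) =
  OnPath-left path , y≢x , _ , OnPath-left path′ , _ , _ , _ , left s

LS-right : LS r x y → LS (node l z r) x y
LS-right (path , y≢x , _ , path′ , _ , _ , _ , s) =
  OnPath-right path , y≢x , _ , OnPath-right path′ , _ , _ , _ , right s

module _ (p : Pre (suc k) m l) (q : Pre m e r) where

  -- Membership in `LS` lifts from a subtree to the whole tree, unlike the absence of smaller labels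
  -- to the right, which refers to the whole tree and is therefore added only at the end, in
  -- `Step⇒Rotation`.
  IsLSRotation-left : IsLSRotation l s → IsLSRotation (node l k r) (node s k r)
  IsLSRotation-left rot = record
    { 𝔫-left = left 𝔫-left
    ; inLS   = LS-left inLS
    ; S      = S
    ; at-𝔫ₐ  = subst (_ ⊑_) (sym T₂-left) (left at-𝔫ₐ)
    ; glued  = trans (cong (λ t → node t k r) glued)
        (trans (sym (replaceAt-Preˡ p q _ (LS⇒∈ᵀ inLS))) (cong (replaceAt 𝔫ₐ _) (sym T₂-left)))
    }
    where
    open IsLSRotation rot
    T₂-left : T₂ lₙ S 𝔫₀ r₀ (node l k r) ≡ node (T₂ lₙ S 𝔫₀ r₀ l) k r
    T₂-left = replaceAt-Preˡ p q l (⊑⇒∈ᵀ 𝔫-left)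

  IsLSRotation-right : IsLSRotation r s → IsLSRotation (node l k r) (node l k s)
  IsLSRotation-right rot = record
    { 𝔫-left = right 𝔫-left
    ; inLS   = LS-right inLS
    ; S      = S
    ; at-𝔫ₐ  = subst (_ ⊑_) (sym T₂-right) (right at-𝔫ₐ)
    ; glued  = trans (cong (node l k) glued)
        (trans (sym (replaceAt-Preʳ p q _ (LS⇒∈ᵀ inLS))) (cong (replaceAt 𝔫ₐ _) (sym T₂-right)))
    }
    where
    open IsLSRotation rot
    T₂-right : T₂ lₙ S 𝔫₀ r₀ (node l k r) ≡ node l k (T₂ lₙ S 𝔫₀ r₀ r)
    T₂-right = replaceAt-Preʳ p q r (⊑⇒∈ᵀ 𝔫-left)

select-full : ∀ (xs : List A) → select xs full ≡ xs
select-full []       = refl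
select-full (x ∷ xs) = cong (x ∷_) (select-full xs)

select-∁full : ∀ (xs : List A) → select xs (∁ full) ≡ []
select-∁full []       = refl
select-∁full (x ∷ xs) = select-∁full xs

linkLeft-leftSpine : ∀ t → linkLeft (leftSpine t) ≡ t
linkLeft-leftSpine leaf         = refl
linkLeft-leftSpine (node l x r) = cong (λ l → node l x r) (linkLeft-leftSpine l)

-- With all of the 𝔪ᵢ selected, `T₁` is the whole subtree at `𝔫`, and `T₂` is `L` with that subtree
-- removed.
T₁-full : ∀ l 𝔫 r → T₁ l full 𝔫 r ≡ node l 𝔫 r
T₁-full l 𝔫 r = cong (λ l → node l 𝔫 r)
  (trans (cong linkLeft (select-full (leftSpine l))) (linkLeft-leftSpine l))

T₂-full : ∀ l 𝔫₀ r₀ L → T₂ l full 𝔫₀ r₀ L ≡ replaceAt 𝔫₀ (node leaf 𝔫₀ r₀) L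
T₂-full l 𝔫₀ r₀ L = cong (λ ns → replaceAt 𝔫₀ (node (linkLeft ns) 𝔫₀ r₀) L) (select-∁full (leftSpine l))

linkRight-++ : ∀ s r → linkRight (rightSpine s ++ rightSpine r) ≡ append s r
linkRight-++ (node l x s) r = cong (node l x) (linkRight-++ s r)
linkRight-++ leaf         r = linkRight-rightSpine r
  where
  linkRight-rightSpine : ∀ t → linkRight (rightSpine t) ≡ t
  linkRight-rightSpine leaf         = refl
  linkRight-rightSpine (node l x r) = cong (node l x) (linkRight-rightSpine r)

rightSpine⇒spine : ∀ t {h} → h ∈ rightSpine t → proj₁ h ∈ spine t
rightSpine⇒spine (node _ _ _) (here refl) = here refl
rightSpine⇒spine (node _ _ r) (there h∈)  = there (rightSpine⇒spine r h∈)

mergeByLabel-++ : ∀ ms ns → (∀ {h i} → h ∈ ms → i ∈ ns → proj₁ h ≤ proj₁ i) →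
                  mergeByLabel ms ns ≡ ms ++ ns
mergeByLabel-++ []       ns       _  = refl
mergeByLabel-++ (h ∷ ms) []       _  = cong (h ∷_) (sym (++-identityʳ ms))
mergeByLabel-++ (h ∷ ms) (i ∷ ns) h≤i
  rewrite dec-true (proj₁ h ≤? proj₁ i) (h≤i (here refl) (here refl)) =
  cong (h ∷_) (mergeByLabel-++ ms (i ∷ ns) (h≤i ∘ there))

mergeByLabel-> : ∀ {h i} ms ns → proj₁ i < proj₁ h →
                 mergeByLabel (h ∷ ms) (i ∷ ns) ≡ i ∷ mergeByLabel (h ∷ ms) ns
mergeByLabel-> {h} {i} ms ns i<h rewrite dec-false (proj₁ h ≤? proj₁ i) (<⇒≱ i<h) = refl

-- The merge sort reduces to concatenation: `k` comes first, the chain of `m` stays below `j`, and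
-- the chain of `r` starts at `j`.
glue-full : ∀ {l₁ l₂ r₂ j} → Pre (suc k) m l₁ → Pre m j (node l₂ m r₂) → Pre j e r →
            linkRight (mergeByLabel (rightSpine (node l₂ m r₂)) (rightSpine (node l₁ k r)))
            ≡ node l₁ k (append (node l₂ m r₂) r)
glue-full {r = r} {l₁} {l₂} {r₂} p p′ q = trans
  (cong linkRight (mergeByLabel-> (rightSpine r₂) (rightSpine r) (Pre-≤ p)))
  (cong (node l₁ _) (trans
    (cong linkRight (mergeByLabel-++ (rightSpine s₂) (rightSpine r) λ h∈ i∈ →
      <⇒≤ (<-≤-trans (proj₂ (Pre-bounds p′ (spine⇒∈ᵀ s₂ (rightSpine⇒spine s₂ h∈))))
                     (spine-≥ q (rightSpine⇒spine r i∈)))))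
    (linkRight-++ s₂ r)))
  where
  s₂ : Tree
  s₂ = node l₂ _ r₂

-- Supplies `𝔫₀`, the last node in preorder of the first tree: cutting its left edge undoes the
-- graft. The first tree is nonempty, as otherwise the parent lies outside the graft.
graft-parent : Pre k m (node l x r) → Pre m e s →
  ∃[ z ] (node s z leaf ⊑ graft (node l x r) s ×
          replaceAt z (node leaf z leaf) (graft (node l x r) s) ≡ node l x r)
graft-parent {k} (node leaf leaf) q = k , here , replaceAt-root
graft-parent {k} (node p@(node _ _) leaf) q
  with z , s⊑ , eq ← graft-parent p q
  = z , left s⊑ , trans (replaceAt-Preˡ (Pre-graft p q) leaf _ (⊑⇒∈ᵀ s⊑)) (cong (λ l → node l k leaf) eq)
graft-parent {k} (node {l = l} p p′@(node _ _)) q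
  with z , s⊑ , eq ← graft-parent p′ q
  = z , right s⊑ , trans (replaceAt-Preʳ p (Pre-graft p′ q) _ (⊑⇒∈ᵀ s⊑)) (cong (node l k) eq)

graft-∈ : ∀ t → x ∈ᵀ s → x ∈ᵀ graft t s
graft-∈ leaf                      x∈ = x∈
graft-∈ (node l _ leaf)           x∈ = inLeft (graft-∈ l x∈)
graft-∈ (node _ _ r@(node _ _ _)) x∈ = inRight (graft-∈ r x∈)

LS-root : Pre k e (node l k r) → x ∈ᵀ l → LS (node l k r) x k
LS-root {l = node _ _ _} (node p q) x∈ =
  OnPath-root (inLeft x∈) , (λ { refl → n≮n _ (proj₁ (Pre-bounds p x∈)) }) ,
  _ , OnPath-left (OnPath-root x∈) , _ , _ , _ , here

-- The merge at the root is the rotation with `𝔫 = m`, `𝔫ₐ = k` and `S` full; only `𝔫₀` depends on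
-- the shape of `l₁`.
Step⇒LSRotation : Step k e t u → IsLSRotation t u
Step⇒LSRotation (stepˡ s q) = IsLSRotation-left (Step⇒Preˡ s) q (Step⇒LSRotation s)
Step⇒LSRotation (stepʳ p s) = IsLSRotation-right p (Step⇒Preˡ s) (Step⇒LSRotation s)
Step⇒LSRotation {k} (rotate {m = m} {r = r} {l₁ = l₁} {l₂} {r₂} p p′ q) = fromParent (parent p)
  where
  L = node (graft l₁ (node l₂ m r₂)) k r
  parent : Pre (suc k) m l₁ → ∃₂ λ z r₀ → node (node l₂ m r₂) z r₀ ⊑ L ×
             replaceAt z (node leaf z r₀) L ≡ node l₁ k r
  -- With `l₁` empty, `m` is the left child of `k`, and `𝔫₀` coincides with `𝔫ₐ`.
  parent leaf        = k , r , here , replaceAt-root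
  parent p@(node _ _) with z , s⊑ , eq ← graft-parent p p′ =
    z , leaf , left s⊑ , trans (replaceAt-Preˡ (Pre-graft p p′) q _ (⊑⇒∈ᵀ s⊑)) (cong (λ l → node l k r) eq)
  fromParent : (∃₂ λ z r₀ → node (node l₂ m r₂) z r₀ ⊑ L ×
                 replaceAt z (node leaf z r₀) L ≡ node l₁ k r) → IsLSRotation L _
  fromParent (z , r₀ , s⊑ , eq) = record
    { 𝔫-left = s⊑
    ; inLS   = LS-root (node (Pre-graft p p′) q) (graft-∈ l₁ root)
    ; S      = full
    ; at-𝔫ₐ  = subst (node l₁ k r ⊑_) (sym T₂≡) here
    ; glued  = sym (trans (cong (glue (T₁ l₂ full m r₂) k (node l₁ k r)) T₂≡) (trans replaceAt-root
        (trans (cong (λ t → linkRight (mergeByLabel (rightSpine t) (rightSpine (node l₁ k r)))) (T₁-full l₂ m r₂))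
          (glue-full p p′ q))))
    }
    where
    T₂≡ : T₂ l₂ full z r₀ L ≡ node l₁ k r
    T₂≡ = trans (T₂-full l₂ z r₀ L) eq

-- In preorder a left subtree has smaller labels than the right subtree of the same node; hence the
-- first alternative of `Admissible` applies.
Pre⇒¬SmallerRightTo : Pre k e t → ¬ SmallerRightTo t x y
Pre⇒¬SmallerRightTo {x = x} p (y<x , _ , l , r , s , y∈ , x∈)
  with _ , _ , node p₁ p₂ ← ⊑-Pre s p =
  n≮n x (<-trans (<-≤-trans (proj₂ (Pre-bounds p₁ (∈⇒∈ᵀ l x∈))) (proj₁ (Pre-bounds p₂ (∈⇒∈ᵀ r y∈)))) y<x)

Step⇒Rotation : Step k e t u → IsRotation t u
Step⇒Rotation s = record
  { 𝔫-left     = 𝔫-left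
  ; admissible = inj₁ (Pre⇒¬SmallerRightTo (Step⇒Preˡ s) , inLS)
  ; S          = S
  ; at-𝔫ₐ      = at-𝔫ₐ
  ; glued      = glued
  }
  where open IsLSRotation (Step⇒LSRotation s)

PreTree⇒NCCP : Pre 1 (suc n) t → IsNCCP n (runs (inorder t))
PreTree⇒NCCP p = runs-isNCCP (Pre⇒↭ p)

PreTree⇒treeOf : Pre 1 (suc n) t → IsTreeOf n (runs (inorder t)) t
PreTree⇒treeOf {t = t} p = Pre⇒labeled p , sym (word-runs (inorder t))

Step⇒Cover : Step 1 (suc n) t u → Cover n (runs (inorder t)) (runs (inorder u))
Step⇒Cover s = PreTree⇒NCCP p , PreTree⇒NCCP q , _ , _ , PreTree⇒treeOf p , PreTree⇒treeOf q , Step⇒Rotation s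
  where
  p = Step⇒Preˡ s
  q = Step⇒Preʳ s

≼⇒≤ : Pre 1 (suc n) t → Pre 1 (suc n) u → t ≼ u → Star (Cover n) (runs (inorder t)) (runs (inorder u))
≼⇒≤ p q t≼u = gmap (λ t → runs (inorder t)) Step⇒Cover (≼⇒Steps p q t≼u)

-- Monotonicity of rotations

⊑-trans : r ⊑ s → s ⊑ t → r ⊑ t
⊑-trans p here      = p
⊑-trans p (left q)  = left (⊑-trans p q)
⊑-trans p (right q) = right (⊑-trans p q)

RightChild-⊑ : s ⊑ t → RightChild s y x → RightChild t y x
RightChild-⊑ p (_ , _ , _ , q) = _ , _ , _ , ⊑-trans q p

Same-⊑ : s ⊑ t → s ≼ t
Same-⊑ here      v = v
Same-⊑ (left p)  v = inl (Same-⊑ p v)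
Same-⊑ (right p) v = inr (Same-⊑ p v)

RightChild⇒Same : RightChild t y x → Same t y x
RightChild⇒Same (_ , _ , _ , p) = Same-⊑ p (onSpine (there (here refl)) (here refl))

spine⇒path : ∀ t → x ∈ spine (node l z t) → Star (RightChild (node l z t)) x z
spine⇒path _            (here refl) = ε
spine⇒path (node _ _ t) (there x∈)  =
  gmap id (RightChild-⊑ (right here)) (spine⇒path t x∈) ◅◅ (_ , _ , _ , here) ◅ ε

Same⇒paths : Same t x y → ∃[ z ] (z ∈ᵀ t × Star (RightChild t) x z × Star (RightChild t) y z)
Same⇒paths {node _ z t} (onSpine x∈ y∈) = z , root , spine⇒path t x∈ , spine⇒path t y∈
Same⇒paths (inl v) with z , z∈ , p , q ← Same⇒paths v =
  z , inLeft z∈ , gmap id (RightChild-⊑ (left here)) p , gmap id (RightChild-⊑ (left here)) q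
Same⇒paths (inr v) with z , z∈ , p , q ← Same⇒paths v =
  z , inRight z∈ , gmap id (RightChild-⊑ (right here)) p , gmap id (RightChild-⊑ (right here)) q

-- Chains are generated by their right edges: two members are joined through the top of their common
-- part of the chain.
edges⇒≼ : Unique (inorder u) → (∀ {x} → x ∈ᵀ t → x ∈ᵀ u) →
          (∀ {x y} → RightChild t y x → Same u y x) → t ≼ u
edges⇒≼ {u} uniq t⊆u edge v with z , z∈ , p , q ← Same⇒paths v =
  Same-trans uniq (path p) (Same-sym (path q))
  where
  path : Star (RightChild _) x _ → Same u x _
  path ε        = Same-refl (t⊆u z∈)
  path (e ◅ es) = Same-trans uniq (edge e) (path es)

Unique-resp-⊇ : xs ⊆ ys → Unique ys → Unique xs
Unique-resp-⊇ []         []       = []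
Unique-resp-⊇ (y ∷ʳ τ)   (_ ∷ u)  = Unique-resp-⊇ τ u
Unique-resp-⊇ (refl ∷ τ) (y≢ ∷ u) = All-resp-⊆ τ y≢ ∷ Unique-resp-⊇ τ u

subtree-unique : ∀ {l′ r′} → Unique (inorder t) → node l x r ⊑ t → node l′ x r′ ⊑ t → node l x r ≡ node l′ x r′
subtree-unique u here here = refl
subtree-unique u here (left q)  = contradiction (here refl) (Unique-disjoint u (∈ᵀ⇒∈ (⊑⇒∈ᵀ q)))
subtree-unique u (left p) here  = contradiction (here refl) (Unique-disjoint u (∈ᵀ⇒∈ (⊑⇒∈ᵀ p)))
subtree-unique {node l z r} u here (right q) with z≢ ∷ _ ← Unique-++⁻ʳ (inorder l) u =
  contradiction refl (All.lookup z≢ (∈ᵀ⇒∈ (⊑⇒∈ᵀ q)))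
subtree-unique {node l z r} u (right p) here with z≢ ∷ _ ← Unique-++⁻ʳ (inorder l) u =
  contradiction refl (All.lookup z≢ (∈ᵀ⇒∈ (⊑⇒∈ᵀ p)))
subtree-unique {node l z r} u (left p) (left q) = subtree-unique (Unique-++⁻ˡ (inorder l) u) p q
subtree-unique u (left p) (right q) =
  contradiction (there (∈ᵀ⇒∈ (⊑⇒∈ᵀ q))) (Unique-disjoint u (∈ᵀ⇒∈ (⊑⇒∈ᵀ p)))
subtree-unique u (right p) (left q) =
  contradiction (there (∈ᵀ⇒∈ (⊑⇒∈ᵀ p))) (Unique-disjoint u (∈ᵀ⇒∈ (⊑⇒∈ᵀ q)))
subtree-unique {node l z r} u (right p) (right q) with _ ∷ u′ ← Unique-++⁻ʳ (inorder l) u =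
  subtree-unique u′ p q

-- An edge either lies within the replaced subtree or survives. The edge leading to that subtree
-- survives because the replacement has the same root label `a`.
RightChild-replaceAt : ∀ {a l₀ r₀} t → RightChild t y x →
  (∃₂ λ l r → node l a r ⊑ t × RightChild (node l a r) y x) ⊎
  RightChild (replaceAt a (node l₀ a r₀) t) y x
RightChild-replaceAt {a = a} (node l z r) e with a ≟ z
... | yes refl = inj₁ (l , r , here , e)
RightChild-replaceAt {a = a} (node l z (node _ y _)) (_ , _ , _ , here) | no _ with a ≟ y
... | yes refl = inj₂ (_ , _ , _ , here)
... | no _     = inj₂ (_ , _ , _ , here)
RightChild-replaceAt (node l z r) (_ , _ , _ , left p) | no _ = Sum.map
  (λ (l′ , r′ , q , e) → l′ , r′ , left q , e) (RightChild-⊑ (left here)) (RightChild-replaceAt l (_ , _ , _ , p))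
RightChild-replaceAt (node l z r) (_ , _ , _ , right p) | no _ = Sum.map
  (λ (l′ , r′ , q , e) → l′ , r′ , right q , e) (RightChild-⊑ (right here)) (RightChild-replaceAt r (_ , _ , _ , p))

replaceAt-⊑ : x ∈ᵀ t → s ⊑ replaceAt x s t
replaceAt-⊑ {x} {node l z r} x∈ with x ≟ z
... | yes refl = here
replaceAt-⊑ root         | no x≢z = contradiction refl x≢z
replaceAt-⊑ (inLeft x∈)  | no _   = left (replaceAt-⊑ x∈)
replaceAt-⊑ (inRight x∈) | no _   = right (replaceAt-⊑ x∈)

inorder-replaceAt : ∀ t → (∀ {l r} → node l x r ⊑ t → inorder s ⊆ inorder (node l x r)) →
                    inorder (replaceAt x s t) ⊆ inorder t
inorder-replaceAt leaf _ = []
inorder-replaceAt {x} (node l z r) s⊆ with x ≟ z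
... | yes refl = s⊆ here
... | no _     = ⊆-++⁺ (inorder-replaceAt l (s⊆ ∘ left)) (refl ∷ inorder-replaceAt r (s⊆ ∘ right))

inorder-select : ∀ ns (S : Subset (length ns)) → inorder (linkLeft (select ns S)) ⊆ inorder (linkLeft ns)
inorder-select []             []          = []
inorder-select ((x , t) ∷ ns) (true  ∷ S) = ⊆-++⁺ (inorder-select ns S) ⊆-refl
inorder-select ((x , t) ∷ ns) (false ∷ S) = ⊆-++⁺ʳ (x ∷ inorder t) (inorder-select ns S)

-- Right subtrees hang on the left spine as a whole, so distributing the spine over two trees breaks
-- no right edge.
RightChild-select : ∀ ns (S : Subset (length ns)) → RightChild (linkLeft ns) y x →
  RightChild (linkLeft (select ns S)) y x ⊎ RightChild (linkLeft (select ns (∁ S))) y x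
RightChild-select []             []      (_ , _ , _ , ())
RightChild-select ((z , _) ∷ ns) (true  ∷ S) (_ , _ , _ , here)    = inj₁ (_ , _ , _ , here)
RightChild-select ((z , _) ∷ ns) (true  ∷ S) (_ , _ , _ , right p) = inj₁ (_ , _ , _ , right p)
RightChild-select ((z , _) ∷ ns) (true  ∷ S) (_ , _ , _ , left p)  =
  Sum.map₁ (RightChild-⊑ (left here)) (RightChild-select ns S (_ , _ , _ , p))
RightChild-select ((z , _) ∷ ns) (false ∷ S) (_ , _ , _ , here)    = inj₂ (_ , _ , _ , here)
RightChild-select ((z , _) ∷ ns) (false ∷ S) (_ , _ , _ , right p) = inj₂ (_ , _ , _ , right p)
RightChild-select ((z , _) ∷ ns) (false ∷ S) (_ , _ , _ , left p)  =
  Sum.map₂ (RightChild-⊑ (left here)) (RightChild-select ns S (_ , _ , _ , p))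

linkRight-spine : ∀ {ns} → (x , s) ∈ ns → x ∈ spine (linkRight ns)
linkRight-spine (here refl) = here refl
linkRight-spine (there h∈)  = there (linkRight-spine h∈)

linkRight-⊒ : ∀ {ns} → (x , s) ∈ ns → s ⊑ linkRight ns
linkRight-⊒ (here refl) = left here
linkRight-⊒ (there h∈)  = right (linkRight-⊒ h∈)

-- Merging may separate neighbours on the chain, so an edge of the chain survives only as `Same`;
-- edges inside the hanging left subtrees stay as they are.
RightChild-linkRight : ∀ t {ns} → (∀ {h} → h ∈ rightSpine t → h ∈ ns) →
                       RightChild t y x → Same (linkRight ns) y x
RightChild-linkRight (node _ _ (node _ _ _)) ⊆ns (_ , _ , _ , here) =
  onSpine (linkRight-spine (⊆ns (there (here refl)))) (linkRight-spine (⊆ns (here refl)))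
RightChild-linkRight (node l _ _) ⊆ns (_ , _ , _ , left p) =
  Same-⊑ (linkRight-⊒ (⊆ns (here refl))) (RightChild⇒Same (_ , _ , _ , p))
RightChild-linkRight (node _ _ r) ⊆ns (_ , _ , _ , right p) =
  RightChild-linkRight r (⊆ns ∘ there) (_ , _ , _ , p)

OnPath-≤ : (∀ {x y} → Child t y x → x < y) → OnPath t x y → y ≤ x
OnPath-≤ inc ε        = ≤-refl
OnPath-≤ inc (c ◅ cs) = ≤-trans (OnPath-≤ inc cs) (<⇒≤ (inc c))

Admissible⇒LS : Admissible t x y → LS t x y
Admissible⇒LS (inj₁ (_ , ls))                  = ls
Admissible⇒LS (inj₂ (_ , _ , _ , _ , ls , _)) = ls

-- Stated for all labeled trees, as the intermediate partitions of a chain of covers are arbitrary.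
-- Every right edge of `L` survives in `T₁` or in `T₂`, and gluing keeps its ends on a common chain.
Rotation⇒≼ : ∀ {L L′} → IsLabeledTree n L → IsLabeledTree n L′ → IsRotation L L′ → L ≼ L′
Rotation⇒≼ {L = L} {L′} p q rot = edges⇒≼ (↭-range-unique (IsLabeledTree.labels q))
    (λ {x} x∈ → ∈⇒∈ᵀ L′ (∈-resp-↭ (↭-sym (IsLabeledTree.labels q)) (∈-resp-↭ (IsLabeledTree.labels p) (∈ᵀ⇒∈ x∈))))
    (λ e → [ T₁-edge , T₂-edge ]′ (L-edge e))
  where
  open IsRotation rot renaming (l to lₙ; r to rₙ)
  t₁ t₂ kept chain : Tree
  t₁ = T₁ lₙ S 𝔫 rₙ
  t₂ = T₂ lₙ S 𝔫₀ r₀ L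
  kept = linkLeft ((𝔫₀ , r₀) ∷ select (leftSpine lₙ) (∁ S))
  chain = linkRight (mergeByLabel (rightSpine t₁) (rightSpine (node lₐ 𝔫ₐ rₐ)))

  L-unique : Unique (inorder L)
  L-unique = ↭-range-unique (IsLabeledTree.labels p)

  -- Distinct labels in `T₂` ensure that the subtree replaced during gluing is the one given by
  -- `at-𝔫ₐ`.
  t₂-unique : Unique (inorder t₂)
  t₂-unique = Unique-resp-⊇ (inorder-replaceAt L kept⊆) L-unique
    where
    kept⊆ : ∀ {l₁ r₁} → node l₁ 𝔫₀ r₁ ⊑ L → inorder kept ⊆ inorder (node l₁ 𝔫₀ r₁)
    kept⊆ s with refl ← subtree-unique L-unique s 𝔫-left =
      ⊆-++⁺ (⊆-++⁺ʳ _ (subst (λ t → inorder (linkLeft (select (leftSpine lₙ) (∁ S))) ⊆ inorder t) (linkLeft-leftSpine lₙ) (inorder-select (leftSpine lₙ) (∁ S)))) ⊆-refl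

  L-edge : RightChild L y x → RightChild t₁ y x ⊎ RightChild t₂ y x
  L-edge e with RightChild-replaceAt {l₀ = linkLeft (select (leftSpine lₙ) (∁ S))} {r₀} L e
  ... | inj₂ e′ = inj₂ e′
  ... | inj₁ (_ , _ , s , e′) with refl ← subtree-unique L-unique s 𝔫-left = cut e′
    where
    inT₂ : RightChild kept y x → RightChild t₂ y x
    inT₂ = RightChild-⊑ (replaceAt-⊑ (⊑⇒∈ᵀ 𝔫-left))
    cut : RightChild (node (node lₙ 𝔫 rₙ) 𝔫₀ r₀) y x → RightChild t₁ y x ⊎ RightChild t₂ y x
    cut (_ , _ , _ , here)           = inj₂ (inT₂ (_ , _ , _ , here))
    cut (_ , _ , _ , right s)        = inj₂ (inT₂ (_ , _ , _ , right s))
    cut (_ , _ , _ , left here)      = inj₁ (_ , _ , _ , here)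
    cut (_ , _ , _ , left (right s)) = inj₁ (_ , _ , _ , right s)
    cut (_ , _ , _ , left (left s))  = Sum.map (RightChild-⊑ (left here)) (inT₂ ∘ RightChild-⊑ (left here))
      (RightChild-select (leftSpine lₙ) S (subst (λ t → RightChild t _ _) (sym (linkLeft-leftSpine lₙ)) (_ , _ , _ , s)))

  𝔫ₐ<𝔫 : 𝔫ₐ < 𝔫
  𝔫ₐ<𝔫 with path , 𝔫ₐ≢𝔫 , _ ← Admissible⇒LS admissible =
    ≤∧≢⇒< (OnPath-≤ (IsLabeledTree.increasing p) path) 𝔫ₐ≢𝔫

  -- Since `𝔫ₐ < 𝔫`, the merged chain starts with `𝔫ₐ`, the root label that `RightChild-replaceAt`
  -- expects of the replacement.
  chain-root : ∃[ r₁ ] chain ≡ node lₐ 𝔫ₐ r₁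
  chain-root = _ , cong linkRight (mergeByLabel-> (rightSpine rₙ) (rightSpine rₐ) 𝔫ₐ<𝔫)

  chain⊑L′ : chain ⊑ L′
  chain⊑L′ = subst (chain ⊑_) (sym glued) (replaceAt-⊑ (⊑⇒∈ᵀ at-𝔫ₐ))

  merged : ∀ {h} → h ∈ rightSpine t₁ ++ rightSpine (node lₐ 𝔫ₐ rₐ) →
           h ∈ mergeByLabel (rightSpine t₁) (rightSpine (node lₐ 𝔫ₐ rₐ))
  merged = ∈-resp-↭ (↭-sym (merge-↭ _ (rightSpine t₁) _))

  T₁-edge : RightChild t₁ y x → Same L′ y x
  T₁-edge e = Same-⊑ chain⊑L′ (RightChild-linkRight t₁ (merged ∘ ∈-++⁺ˡ) e)

  T₂-edge : RightChild t₂ y x → Same L′ y x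
  T₂-edge e with r₁ , eq ← chain-root with RightChild-replaceAt {l₀ = lₐ} {r₁} t₂ e
  ... | inj₂ e′ = RightChild⇒Same (subst (λ t → RightChild t _ _)
                    (sym (trans glued (cong (λ s → replaceAt 𝔫ₐ s t₂) eq))) e′)
  ... | inj₁ (_ , _ , s , e′) with refl ← subtree-unique t₂-unique s at-𝔫ₐ =
    Same-⊑ chain⊑L′ (RightChild-linkRight (node lₐ 𝔫ₐ rₐ) (merged ∘ ∈-++⁺ʳ (rightSpine t₁)) e′)

-- Each cover brings its own trees; `inorder-injective`, the injectivity of φ, identifies them with
-- the tree at hand, so that the inclusions compose.
≤⇒≼ : IsTreeOf n π t → IsTreeOf n ρ u → Star (Cover n) π ρ → t ≼ u
≤⇒≼ (p , eq) (q , eq′) ε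
  with refl ← inorder-injective (labeled⇒Heap p) (labeled⇒Heap q) (trans eq (sym eq′)) = id
≤⇒≼ (p , eq) q ((_ , _ , L , L′ , (p′ , eq′) , p″ , rot) ◅ covers)
  with refl ← inorder-injective (labeled⇒Heap p) (labeled⇒Heap p′) (trans eq (sym eq′)) =
  λ s → ≤⇒≼ p″ q covers (Rotation⇒≼ p′ (proj₁ p″) rot s)

-- The isomorphism

Pre⇒Heap : Pre 1 (suc n) t → Heap t
Pre⇒Heap p = labeled⇒Heap (Pre⇒labeled p)

tree₃₁₂ : NCCP312 n → PreTree n
tree₃₁₂ π = let t , p , _ = NCCP312⇒PreTree π in t , p

tree₃₁₂-word : (π : NCCP312 n) → inorder (proj₁ (tree₃₁₂ π)) ≡ word (proj₁ π)
tree₃₁₂-word π = proj₂ (proj₂ (NCCP312⇒PreTree π))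

partition₃₁₂ : PreTree n → NCCP312 n
partition₃₁₂ (t , p) =
  runs (inorder t) , PreTree⇒NCCP p , subst Avoids312 (sym (word-runs (inorder t))) (Pre-avoids p)

tree₃₁₂-partition₃₁₂ : (a : PreTree n) → proj₁ (tree₃₁₂ (partition₃₁₂ a)) ≡ proj₁ a
tree₃₁₂-partition₃₁₂ a@(t , p) = inorder-injective (Pre⇒Heap (proj₂ (tree₃₁₂ (partition₃₁₂ a)))) (Pre⇒Heap p)
  (trans (tree₃₁₂-word (partition₃₁₂ a)) (word-runs (inorder t)))

runs-tree₃₁₂ : (π : NCCP312 n) → runs (inorder (proj₁ (tree₃₁₂ π))) ≡ proj₁ π
runs-tree₃₁₂ π = trans (cong runs (tree₃₁₂-word π)) (NCCP-≡ (proj₁ (proj₂ π)))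

tree₃₁₂-cong : (π ρ : NCCP312 n) → proj₁ π ≡ proj₁ ρ → proj₁ (tree₃₁₂ π) ≡ proj₁ (tree₃₁₂ ρ)
tree₃₁₂-cong π ρ eq = inorder-injective (Pre⇒Heap (proj₂ (tree₃₁₂ π))) (Pre⇒Heap (proj₂ (tree₃₁₂ ρ)))
  (trans (tree₃₁₂-word π) (trans (cong word eq) (sym (tree₃₁₂-word ρ))))

tree₃₁₂-injective : (π ρ : NCCP312 n) → proj₁ (tree₃₁₂ π) ≡ proj₁ (tree₃₁₂ ρ) → proj₁ π ≡ proj₁ ρ
tree₃₁₂-injective π ρ eq = trans (sym (runs-tree₃₁₂ π)) (trans (cong (λ t → runs (inorder t)) eq) (runs-tree₃₁₂ ρ))

tree₃₁₂-mono : (π ρ : NCCP312 n) → NCCP312-≤ n π ρ → proj₁ (tree₃₁₂ π) ≼ proj₁ (tree₃₁₂ ρ)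
tree₃₁₂-mono π ρ = ≤⇒≼ (Pre⇒labeled (proj₂ (tree₃₁₂ π)) , tree₃₁₂-word π)
                       (Pre⇒labeled (proj₂ (tree₃₁₂ ρ)) , tree₃₁₂-word ρ)

tree₃₁₂-cancel : (π ρ : NCCP312 n) → proj₁ (tree₃₁₂ π) ≼ proj₁ (tree₃₁₂ ρ) → NCCP312-≤ n π ρ
tree₃₁₂-cancel {n} π ρ π≼ρ = subst₂ (Star (Cover n)) (runs-tree₃₁₂ π) (runs-tree₃₁₂ ρ)
  (≼⇒≤ (proj₂ (tree₃₁₂ π)) (proj₂ (tree₃₁₂ ρ)) π≼ρ)

NCCP312-lattice : ∀ n → IsLatticeOrder (NCCP312-≈ n) (NCCP312-≤ n)
NCCP312-lattice n = transportLattice {_≤₂_ = _≼_ on proj₁} tree₃₁₂ partition₃₁₂ tree₃₁₂-partition₃₁₂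
  (λ {π} {ρ} → tree₃₁₂-cong π ρ) (λ {π} {ρ} → tree₃₁₂-injective π ρ)
  (λ {π} {ρ} → tree₃₁₂-mono π ρ) (λ {π} {ρ} → tree₃₁₂-cancel π ρ)
  (PreTree-lattice n)

chainsNCP : PreTree n → NCP n
chainsNCP (t , p) = chains t , chains-isNCP p

treeNCP : NCP n → PreTree n
treeNCP π = let t , p , _ = NCP⇒PreTree π in t , p

chains-treeNCP : (π : NCP n) → chains (proj₁ (treeNCP π)) ≡ proj₁ π
chains-treeNCP π = proj₂ (proj₂ (NCP⇒PreTree π))

Refines⇒≼ : (a b : PreTree n) → Refines (chains (proj₁ a)) (chains (proj₁ b)) → proj₁ a ≼ proj₁ b
Refines⇒≼ (t , p) (u , q) ref =
  ≼ᵇ⇒≼ u (Refines⇒≼ᵇ (IsNCP.isNCCP (chains-isNCP p)) (IsNCP.isNCCP (chains-isNCP q)) ref)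

≼⇒Refines : (a b : PreTree n) → proj₁ a ≼ proj₁ b → Refines (chains (proj₁ a)) (chains (proj₁ b))
≼⇒Refines (t , p) (u , q) t≼u =
  ≼ᵇ⇒Refines (IsNCP.isNCCP (chains-isNCP p)) (IsNCP.isNCCP (chains-isNCP q)) (≼⇒≼ᵇ t≼u)

NCP-lattice : ∀ n → IsLatticeOrder (NCP-≈ n) (NCP-⊆ n)
NCP-lattice n = transportLattice {_≤₁_ = NCP-⊆ n} {_≤₂_ = _≼_ on proj₁} treeNCP chainsNCP
  (λ a → chains-injective (proj₂ (treeNCP (chainsNCP a))) (proj₂ a) (chains-treeNCP (chainsNCP a)))
  (λ {π} {ρ} eq → chains-injective (proj₂ (treeNCP π)) (proj₂ (treeNCP ρ))
    (trans (chains-treeNCP π) (trans eq (sym (chains-treeNCP ρ)))))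
  (λ {π} {ρ} eq → trans (sym (chains-treeNCP π)) (trans (cong chains eq) (chains-treeNCP ρ)))
  (λ {π} {ρ} ref → Refines⇒≼ (treeNCP π) (treeNCP ρ)
    (subst₂ Refines (sym (chains-treeNCP π)) (sym (chains-treeNCP ρ)) ref))
  (λ {π} {ρ} t≼u → subst₂ Refines (chains-treeNCP π) (chains-treeNCP ρ)
    (≼⇒Refines (treeNCP π) (treeNCP ρ) t≼u))
  (PreTree-lattice n)

rightChains-isOrderIsomorphism : ∀ n →
  IsOrderIsomorphism (NCCP312-≈ n) (NCP-≈ n) (NCCP312-≤ n) (NCP-⊆ n) (chainsNCP ∘ tree₃₁₂)
rightChains-isOrderIsomorphism n = record
  { isOrderMonomorphism = record
    { isOrderHomomorphism = record
      { cong = λ {π} {ρ} eq → cong chains (tree₃₁₂-cong π ρ eq)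
      ; mono = λ {π} {ρ} π≤ρ → ≼⇒Refines (tree₃₁₂ π) (tree₃₁₂ ρ) (tree₃₁₂-mono π ρ π≤ρ)
      }
    ; injective = λ {π} {ρ} eq → tree₃₁₂-injective π ρ
        (chains-injective (proj₂ (tree₃₁₂ π)) (proj₂ (tree₃₁₂ ρ)) eq)
    ; cancel = λ {π} {ρ} ref → tree₃₁₂-cancel π ρ (Refines⇒≼ (tree₃₁₂ π) (tree₃₁₂ ρ) ref)
    }
  ; surjective = λ ρ → partition₃₁₂ (treeNCP ρ) , λ {π} eq →
      trans (cong chains (trans (tree₃₁₂-cong π (partition₃₁₂ (treeNCP ρ)) eq) (tree₃₁₂-partition₃₁₂ (treeNCP ρ))))
            (chains-treeNCP ρ)
  }

proposition3p25 : ∀ (n : ℕ) → n ≥ 1 →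
    IsLatticeOrder (NCCP312-≈ n) (NCCP312-≤ n) ×
    IsLatticeOrder (NCP-≈ n) (NCP-⊆ n) ×
    (∃ λ (f : NCCP312 n → NCP n) →
    IsOrderIsomorphism (NCCP312-≈ n) (NCP-≈ n) (NCCP312-≤ n) (NCP-⊆ n) f)
proposition3p25 n _ = NCCP312-lattice n , NCP-lattice n , _ , rightChains-isOrderIsomorphism n
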